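{- Let $p,q\ge 0$ be integers with $p+q\ge 1$, let $V=\mathbb{R}^{p+q}$ with the quadratic form $P(v)=\sum_{i=1}^p v_i^2-\sum_{j=1}^q v_{p+j}^2$, and let $W=\mathbb{R}^m$. Then the self-dual quadratic mappings $Q:W\to V$ are in one-to-one correspondence with the representations $\rho:C_p\otimes C_q\to M(m;\mathbb{R})$ such that $\rho(V)\subset \mathrm{Sym}(m;\mathbb{R})$. The correspondence is $Q(w)=({}^tw\,S_1\,w,\ldots,{}^tw\,S_{p+q}\,w)$ with $S_i=\rho(e_i)$ for $1\le i\le p+q$.
   Context: $C_r$ denotes the real Clifford algebra of the positive definite quadratic form in $r$ variables, i.e. the unital associative $\mathbb{R}$-algebra generated by $e_1,\dots,e_r$ with $e_i^2=1$ and $e_ie_j=-e_je_i$ for $i\neq j$ ($C_0=\mathbb{R}$). $C_p\otimes C_q$ is the ordinary (ungraded) tensor product over $\mathbb{R}$; $e_1,\dots,e_p$ denote the generators of $C_p$ (identified with $e_i\otimes 1$) and $e_{p+1},\dots,e_{p+q}$ the generators of $C_q$ (identified with $1\otimes e_{p+j}$). $V$ is identified with the span of $e_1,\dots,e_{p+q}$ in $C_p\otimes C_q$ (the standard basis), and with its own dual via the standard inner product. Representations are unital algebra homomorphisms. $\mathrm{Sym}(m;\mathbb{R})$ is the space of real symmetric matrices of size $m$. A quadratic mapping $Q:W=\mathbb{R}^m\to V$ is a map of the form $Q(w)=({}^tw\,S_1\,w,\dots,{}^tw\,S_{p+q}\,w)$ with $S_1,\dots,S_{p+q}\in\mathrm{Sym}(m;\mathbb{R})$.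 Put $S(v)=\sum_{i=1}^{p+q}v_iS_i$, $\Omega=\{v\in V: P(v)\ne 0\}$ and let $\phi:\Omega\to\Omega$ be $\phi(v)=\frac12\,\mathrm{grad}\log P(v)=\frac1{P(v)}(v_1,\dots,v_p,-v_{p+1},\dots,-v_{p+q})$. The mapping $Q$ is called self-dual if $S(v)S(\phi(v))=1_m$ for all $v\in\Omega$. -}

module Defs where

open import Level using (_⊔_; 0ℓ) renaming (suc to lsuc)
open import Algebra.Bundles using (Ring; CommutativeRing; AbelianGroup)
open import Algebra.Apartness.Bundles using (HeytingField; HeytingCommutativeRing)
open import Algebra.Module.Structures using (IsLeftModule)
open import Algebra.Morphism.Structures using (IsRingHomomorphism)
import Algebra.Properties.AbelianGroup as AbelianGroupProperties
import Algebra.Properties.Monoid.Sum as MonoidSum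
import Algebra.Properties.Semiring.Sum as SemiringSum
open import Data.Fin using (Fin; zero; suc; _≟_; _↑ˡ_; _↑ʳ_)
import Data.Integer as ℤ
open import Data.Nat as ℕ using (ℕ)
import Data.Nat.Properties as ℕ
open import Data.Product using (Σ; Σ-syntax; _×_; _,_; proj₁; proj₂)
open import Data.Rational as ℚ using (ℚ; 0ℚ; 1ℚ; ½; ∣_∣)
import Data.Rational.Properties as ℚ
open import Data.Rational.Solver using (module +-*-Solver)
open import Data.Sum using (_⊎_; inj₁; inj₂) renaming (map to map⊎)
open import Data.Vec.Functional using (Vector; _++_)
open import Relation.Binary.Bundles using (Setoid)
import Relation.Binary.Reasoning.Setoid as SetoidReasoning
open import Relation.Nullary using (¬_; yes; no; contradiction)
open import Relation.Binary.PropositionalEquality as ≡ using (_≡_; _≢_)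

-- Cauchy sequences of rationals with pointwise operations; two of them are
-- equal when their difference tends to 0, and apart (the constructive ≠) when it
-- is eventually bounded away from 0.
module Real where

  open import Data.Rational using (_+_; _-_; _*_; -_; _<_; _≤_)

  Eventually : (ℕ → Set) → Set
  Eventually Q = Σ[ N ∈ ℕ ] (∀ n → N ℕ.≤ n → Q n)

  IsCauchy : (ℕ → ℚ) → Set
  IsCauchy s = ∀ ε → 0ℚ < ε →
    Σ[ N ∈ ℕ ] (∀ i j → N ℕ.≤ i → N ℕ.≤ j → ∣ s i - s j ∣ < ε)

  record ℝ : Set where
    constructor mkℝ
    field
      seq    : ℕ → ℚ
      cauchy : IsCauchy seq
  open ℝ public

  infix 4 _≈_ _#_

  record _≈_ (x y : ℝ) : Set where
    constructor mk≈
    field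
      close : ∀ ε → 0ℚ < ε → Eventually (λ n → ∣ seq x n - seq y n ∣ < ε)
  open _≈_ public

  AwayFromZero : (ℕ → ℚ) → Set
  AwayFromZero s = Σ[ ε ∈ ℚ ] 0ℚ < ε × Eventually (λ n → ε < ∣ s n ∣)

  record _#_ (x y : ℝ) : Set where
    constructor mk#
    field
      apart : AwayFromZero (λ n → seq x n - seq y n)
  open _#_ public

  private
    _∧_ : ∀ {Q R : ℕ → Set} → Eventually Q → Eventually R →
          Eventually (λ n → Q n × R n)
    (M , q) ∧ (N , r) = M ℕ.⊔ N , λ n le →
      q n (ℕ.≤-trans (ℕ.m≤m⊔n M N) le) , r n (ℕ.≤-trans (ℕ.m≤n⊔m M N) le)

    ev-map : ∀ {Q R : ℕ → Set} → (∀ n → Q n → R n) → Eventually Q → Eventually R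
    ev-map f (N , q) = N , λ n le → f n (q n le)

    ev-const : ∀ {Q : Set} → Eventually (λ _ → Q) → Q
    ev-const (N , q) = q N ℕ.≤-refl

    0<* : ∀ {p q} → 0ℚ < p → 0ℚ < q → 0ℚ < p * q
    0<* {p} {q} 0<p 0<q = ≡.subst (_< p * q) (ℚ.*-zeroʳ p)
      (ℚ.*-monoʳ-<-pos p {{ℚ.positive 0<p}} 0<q)

    0<½ : 0ℚ < ½
    0<½ = ℚ.*<* (ℤ.+<+ (ℕ.s≤s ℕ.z≤n))

    0<half : ∀ {ε} → 0ℚ < ε → 0ℚ < ½ * ε
    0<half = 0<* 0<½

    half+half : ∀ ε → ½ * ε + ½ * ε ≡ ε
    half+half ε = ≡.trans (≡.sym (ℚ.*-distribʳ-+ ε ½ ½)) (ℚ.*-identityˡ ε)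

    abs-sym : ∀ p q → ∣ p - q ∣ ≡ ∣ q - p ∣
    abs-sym p q = ≡.trans (≡.sym (ℚ.∣-p∣≡∣p∣ (p - q)))
      (≡.cong ∣_∣ (solve 2 (λ p q → :- (p :- q) := q :- p) ≡.refl p q))
      where open +-*-Solver

    abs-tri : ∀ p q r → ∣ p - r ∣ ≤ ∣ p - q ∣ + ∣ q - r ∣
    abs-tri p q r = ≡.subst (λ z → ∣ z ∣ ≤ ∣ p - q ∣ + ∣ q - r ∣)
      (solve 3 (λ p q r → (p :- q) :+ (q :- r) := p :- r) ≡.refl p q r)
      (ℚ.∣p+q∣≤∣p∣+∣q∣ (p - q) (q - r))
      where open +-*-Solver

    tri-< : ∀ p q r ε → ∣ p - q ∣ < ½ * ε → ∣ q - r ∣ < ½ * ε → ∣ p - r ∣ < ε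
    tri-< p q r ε a b = ℚ.≤-<-trans (abs-tri p q r)
      (≡.subst (∣ p - q ∣ + ∣ q - r ∣ <_) (half+half ε) (ℚ.+-mono-< a b))

    0<⇒≢0 : ∀ {p} → 0ℚ < p → p ≢ 0ℚ
    0<⇒≢0 0<p p≡0 = ℚ.<-irrefl (≡.sym p≡0) 0<p

    scaleDown : ∀ B η → 0ℚ < B → 0ℚ < η → Σ[ δ ∈ ℚ ] 0ℚ < δ × B * δ ≡ η
    scaleDown B η 0<B 0<η = ℚ.1/ B * η , 0<* 0<1/B 0<η ,
      ≡.trans (≡.sym (ℚ.*-assoc B (ℚ.1/ B) η))
        (≡.trans (≡.cong (_* η) (ℚ.*-inverseʳ B)) (ℚ.*-identityˡ η))
      where
      instance
        B-pos : ℚ.Positive B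
        B-pos = ℚ.positive 0<B
        B-nz : ℚ.NonZero B
        B-nz = ℚ.pos⇒nonZero B
      0<1/B : 0ℚ < ℚ.1/ B
      0<1/B = ℚ.positive⁻¹ (ℚ.1/ B) {{ℚ.1/pos⇒pos B}}

    mono-≤ : ∀ {p q r s} → 0ℚ ≤ r → 0ℚ ≤ q → p ≤ q → r ≤ s → p * r ≤ q * s
    mono-≤ {p} {q} {r} {s} 0≤r 0≤q p≤q r≤s = ℚ.≤-trans
      (ℚ.*-monoʳ-≤-nonNeg r {{ℚ.nonNegative 0≤r}} p≤q)
      (ℚ.*-monoˡ-≤-nonNeg q {{ℚ.nonNegative 0≤q}} r≤s)

    *-< : ∀ {a A b δ} → ∣ a ∣ < A → 0ℚ < δ → ∣ b ∣ < δ → ∣ a * b ∣ < A * δ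
    *-< {a} {A} {b} {δ} a<A 0<δ b<δ = begin-strict
      ∣ a * b ∣      ≡⟨ ℚ.∣p*q∣≡∣p∣*∣q∣ a b ⟩
      ∣ a ∣ * ∣ b ∣  ≤⟨ ℚ.*-monoˡ-≤-nonNeg ∣ a ∣ {{ℚ.∣-∣-nonNeg a}} (ℚ.<⇒≤ b<δ) ⟩
      ∣ a ∣ * δ      <⟨ ℚ.*-monoˡ-<-pos δ {{ℚ.positive 0<δ}} a<A ⟩
      A * δ          ∎
      where open ℚ.≤-Reasoning

    product-< : ∀ {a b c d A D δ η} ε → ∣ a ∣ < A → ∣ d ∣ < D →
      0ℚ < δ → 0ℚ < η → ∣ b - d ∣ < δ → ∣ a - c ∣ < η →
      A * δ ≡ ½ * ε → D * η ≡ ½ * ε → ∣ a * b - c * d ∣ < ε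
    product-< {a} {b} {c} {d} ε a<A d<D 0<δ 0<η bd ac Aδ Dη =
      tri-< (a * b) (a * d) (c * d) ε
        (≡.subst₂ _<_ (≡.cong ∣_∣ (solve 3 (λ a b d → a :* (b :- d) := a :* b :- a :* d) ≡.refl a b d))
          Aδ (*-< {a} {b = b - d} a<A 0<δ bd))
        (≡.subst₂ _<_ (≡.cong ∣_∣ (solve 3 (λ a c d → d :* (a :- c) := a :* d :- c :* d) ≡.refl a c d))
          Dη (*-< {d} {b = a - c} d<D 0<η ac))
      where open +-*-Solver

    Bounded : ℝ → Set
    Bounded x = Σ[ B ∈ ℚ ] 0ℚ < B × Eventually (λ n → ∣ seq x n ∣ < B)

    0<1 : 0ℚ < 1ℚ
    0<1 = ℚ.positive⁻¹ 1ℚ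

    bounded : ∀ x → Bounded x
    bounded x = B , 0<B , N , λ n le → ℚ.≤-<-trans (step n)
        (ℚ.+-monoˡ-< ∣ seq x N ∣ (c n N le ℕ.≤-refl))
      where
      N = proj₁ (cauchy x 1ℚ 0<1)
      c = proj₂ (cauchy x 1ℚ 0<1)
      B = 1ℚ + ∣ seq x N ∣
      0<B : 0ℚ < B
      0<B = ℚ.+-mono-<-≤ 0<1 (ℚ.0≤∣p∣ (seq x N))
      step : ∀ n → ∣ seq x n ∣ ≤ ∣ seq x n - seq x N ∣ + ∣ seq x N ∣
      step n = ≡.subst (λ z → ∣ z ∣ ≤ ∣ seq x n - seq x N ∣ + ∣ seq x N ∣)
        (solve 2 (λ p q → (p :- q) :+ q := p) ≡.refl (seq x n) (seq x N))
        (ℚ.∣p+q∣≤∣p∣+∣q∣ (seq x n - seq x N) (seq x N))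
        where open +-*-Solver

    sum-< : ∀ a b c d ε → ∣ a - c ∣ < ½ * ε → ∣ b - d ∣ < ½ * ε → ∣ (a + b) - (c + d) ∣ < ε
    sum-< a b c d ε ac bd = tri-< (a + b) (c + b) (c + d) ε
      (≡.subst (λ z → ∣ z ∣ < ½ * ε) (solve 3 (λ a b c → a :- c := (a :+ b) :- (c :+ b)) ≡.refl a b c) ac)
      (≡.subst (λ z → ∣ z ∣ < ½ * ε) (solve 3 (λ b c d → b :- d := (c :+ b) :- (c :+ d)) ≡.refl b c d) bd)
      where open +-*-Solver

    neg-abs : ∀ a b → ∣ a - b ∣ ≡ ∣ - a - - b ∣
    neg-abs a b = ≡.trans (abs-sym a b)
      (≡.cong ∣_∣ (solve 2 (λ a b → b :- a := :- a :- :- b) ≡.refl a b))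
      where open +-*-Solver

  private abstract
    const-cauchy : ∀ q → IsCauchy (λ _ → q)
    const-cauchy q ε 0<ε = 0 , λ _ _ _ _ →
      ≡.subst (_< ε) (≡.sym (≡.cong ∣_∣ (ℚ.+-inverseʳ q))) 0<ε

    ⊕-cauchy : ∀ x y → IsCauchy (λ n → seq x n + seq y n)
    ⊕-cauchy x y ε 0<ε =
      let (M , p) = cauchy x (½ * ε) (0<half 0<ε)
          (N , q) = cauchy y (½ * ε) (0<half 0<ε)
      in M ℕ.⊔ N , λ i j li lj → sum-< (seq x i) (seq y i) (seq x j) (seq y j) ε
        (p i j (ℕ.≤-trans (ℕ.m≤m⊔n M N) li) (ℕ.≤-trans (ℕ.m≤m⊔n M N) lj))
        (q i j (ℕ.≤-trans (ℕ.m≤n⊔m M N) li) (ℕ.≤-trans (ℕ.m≤n⊔m M N) lj))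

    ⊖-cauchy : ∀ x → IsCauchy (λ n → - seq x n)
    ⊖-cauchy x ε 0<ε =
      let (M , p) = cauchy x ε 0<ε
      in M , λ i j li lj → ≡.subst (_< ε) (neg-abs (seq x i) (seq x j)) (p i j li lj)

    ·-cauchy : ∀ x y → IsCauchy (λ n → seq x n * seq y n)
    ·-cauchy x y ε 0<ε =
      let (A , 0<A , NA , bA) = bounded x
          (D , 0<D , ND , bD) = bounded y
          (δ , 0<δ , Aδ) = scaleDown A (½ * ε) 0<A (0<half 0<ε)
          (η , 0<η , Dη) = scaleDown D (½ * ε) 0<D (0<half 0<ε)
          (M , p) = cauchy x η 0<η
          (N , q) = cauchy y δ 0<δ
          a = ℕ.m≤m⊔n (NA ℕ.⊔ ND) (M ℕ.⊔ N)
          b = ℕ.m≤n⊔m (NA ℕ.⊔ ND) (M ℕ.⊔ N)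
          a₁ = ℕ.≤-trans (ℕ.m≤m⊔n NA ND) a
          a₂ = ℕ.≤-trans (ℕ.m≤n⊔m NA ND) a
          b₁ = ℕ.≤-trans (ℕ.m≤m⊔n M N) b
          b₂ = ℕ.≤-trans (ℕ.m≤n⊔m M N) b
      in (NA ℕ.⊔ ND) ℕ.⊔ (M ℕ.⊔ N) , λ i j li lj →
        product-< {seq x i} {seq y i} {seq x j} {seq y j} ε
          (bA i (ℕ.≤-trans a₁ li)) (bD j (ℕ.≤-trans a₂ lj)) 0<δ 0<η
          (q i j (ℕ.≤-trans b₂ li) (ℕ.≤-trans b₂ lj))
          (p i j (ℕ.≤-trans b₁ li) (ℕ.≤-trans b₁ lj)) Aδ Dη

  infixl 7 _·_
  infixl 6 _⊕_
  infix  8 ⊖_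

  fromℚ : ℚ → ℝ
  fromℚ q = mkℝ (λ _ → q) (const-cauchy q)

  _⊕_ : ℝ → ℝ → ℝ
  x ⊕ y = mkℝ (λ n → seq x n + seq y n) (⊕-cauchy x y)

  ⊖_ : ℝ → ℝ
  ⊖ x = mkℝ (λ n → - seq x n) (⊖-cauchy x)

  _·_ : ℝ → ℝ → ℝ
  x · y = mkℝ (λ n → seq x n * seq y n) (·-cauchy x y)

  ≗⇒≈ : ∀ {x y} → (∀ n → seq x n ≡ seq y n) → x ≈ y
  ≗⇒≈ {x} {y} e = mk≈ λ ε 0<ε → 0 , λ n _ → ≡.subst (_< ε)
    (≡.sym (≡.cong ∣_∣ (≡.trans (≡.cong (λ p → p - seq y n) (e n)) (ℚ.+-inverseʳ (seq y n))))) 0<ε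

  ≈-sym : ∀ {x y} → x ≈ y → y ≈ x
  ≈-sym {x} {y} (mk≈ e) = mk≈ λ ε 0<ε →
    ev-map (λ n → ≡.subst (_< ε) (abs-sym (seq x n) (seq y n))) (e ε 0<ε)

  ≈-trans : ∀ {x y z} → x ≈ y → y ≈ z → x ≈ z
  ≈-trans {x} {y} {z} (mk≈ e) (mk≈ f) = mk≈ λ ε 0<ε →
    ev-map (λ n (a , b) → tri-< (seq x n) (seq y n) (seq z n) ε a b)
      (e (½ * ε) (0<half 0<ε) ∧ f (½ * ε) (0<half 0<ε))

  ⊕-cong : ∀ {x y u v} → x ≈ y → u ≈ v → x ⊕ u ≈ y ⊕ v
  ⊕-cong {x} {y} {u} {v} (mk≈ e) (mk≈ f) = mk≈ λ ε 0<ε →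
    ev-map (λ n (a , b) → sum-< (seq x n) (seq u n) (seq y n) (seq v n) ε a b)
      (e (½ * ε) (0<half 0<ε) ∧ f (½ * ε) (0<half 0<ε))

  ⊖-cong : ∀ {x y} → x ≈ y → ⊖ x ≈ ⊖ y
  ⊖-cong {x} {y} (mk≈ e) = mk≈ λ ε 0<ε →
    ev-map (λ n → ≡.subst (_< ε) (neg-abs (seq x n) (seq y n))) (e ε 0<ε)

  ·-cong : ∀ {x y u v} → x ≈ y → u ≈ v → x · u ≈ y · v
  ·-cong {x} {y} {u} {v} (mk≈ e) (mk≈ f) = mk≈ λ ε 0<ε →
    let (A , 0<A , bA) = bounded x
        (D , 0<D , bD) = bounded v
        (δ , 0<δ , Aδ) = scaleDown A (½ * ε) 0<A (0<half 0<ε)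
        (η , 0<η , Dη) = scaleDown D (½ * ε) 0<D (0<half 0<ε)
    in ev-map (λ n ((a , d) , (b , c)) →
         product-< {seq x n} {seq u n} {seq y n} {seq v n} ε a d 0<δ 0<η c b Aδ Dη)
       ((bA ∧ bD) ∧ (e η 0<η ∧ f δ 0<δ))

  ⊕-assoc : ∀ x y z → (x ⊕ y) ⊕ z ≈ x ⊕ (y ⊕ z)
  ⊕-assoc x y z = ≗⇒≈ λ n → ℚ.+-assoc (seq x n) (seq y n) (seq z n)

  ⊕-comm : ∀ x y → x ⊕ y ≈ y ⊕ x
  ⊕-comm x y = ≗⇒≈ λ n → ℚ.+-comm (seq x n) (seq y n)

  ⊕-identityˡ : ∀ x → fromℚ 0ℚ ⊕ x ≈ x
  ⊕-identityˡ x = ≗⇒≈ λ n → ℚ.+-identityˡ (seq x n)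

  ⊖-inverseˡ : ∀ x → ⊖ x ⊕ x ≈ fromℚ 0ℚ
  ⊖-inverseˡ x = ≗⇒≈ λ n → ℚ.+-inverseˡ (seq x n)

  ·-assoc : ∀ x y z → (x · y) · z ≈ x · (y · z)
  ·-assoc x y z = ≗⇒≈ λ n → ℚ.*-assoc (seq x n) (seq y n) (seq z n)

  ·-comm : ∀ x y → x · y ≈ y · x
  ·-comm x y = ≗⇒≈ λ n → ℚ.*-comm (seq x n) (seq y n)

  ·-identityˡ : ∀ x → fromℚ 1ℚ · x ≈ x
  ·-identityˡ x = ≗⇒≈ λ n → ℚ.*-identityˡ (seq x n)

  ·-distribʳ-⊕ : ∀ x y z → (y ⊕ z) · x ≈ y · x ⊕ z · x
  ·-distribʳ-⊕ x y z = ≗⇒≈ λ n → ℚ.*-distribʳ-+ (seq x n) (seq y n) (seq z n)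

  ≈-setoid : Setoid 0ℓ 0ℓ
  ≈-setoid = record
    { Carrier = ℝ ; _≈_ = _≈_
    ; isEquivalence = record { refl = ≗⇒≈ λ _ → ≡.refl ; sym = ≈-sym ; trans = ≈-trans }
    }

  commutativeRing : CommutativeRing 0ℓ 0ℓ
  commutativeRing = record
    { Carrier = ℝ ; _≈_ = _≈_ ; _+_ = _⊕_ ; _*_ = _·_ ; -_ = ⊖_
    ; 0# = fromℚ 0ℚ ; 1# = fromℚ 1ℚ
    ; isCommutativeRing = record
      { isRing = record
        { +-isAbelianGroup = record
          { isGroup = record
            { isMonoid = record
              { isSemigroup = record
                { isMagma = record
                  { isEquivalence = Setoid.isEquivalence ≈-setoid
                  ; ∙-cong        = ⊕-cong
                  }
                ; assoc = ⊕-assoc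
                }
              ; identity = comm∧idˡ⇒id ⊕-comm ⊕-identityˡ
              }
            ; inverse = comm∧invˡ⇒inv ⊕-comm ⊖-inverseˡ
            ; ⁻¹-cong = ⊖-cong
            }
          ; comm = ⊕-comm
          }
        ; *-cong     = ·-cong
        ; *-assoc    = ·-assoc
        ; *-identity = comm∧idˡ⇒id ·-comm ·-identityˡ
        ; distrib    = comm∧distrʳ⇒distr ⊕-cong ·-comm ·-distribʳ-⊕
        }
      ; *-comm = ·-comm
      }
    }
    where open import Algebra.Consequences.Setoid ≈-setoid

  #-irrefl : ∀ {x y} → x ≈ y → ¬ (x # y)
  #-irrefl (mk≈ e) (mk# (ε , 0<ε , far)) =
    ev-const (ev-map (λ n (a , b) → ℚ.<-asym a b) (e ε 0<ε ∧ far))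

  #-sym : ∀ {x y} → x # y → y # x
  #-sym {x} {y} (mk# (ε , 0<ε , far)) =
    mk# (ε , 0<ε , ev-map (λ n → ≡.subst (ε <_) (abs-sym (seq x n) (seq y n))) far)

  private
    near-far : ∀ a b η → η + η ≤ ∣ a ∣ → ∣ a - b ∣ < η → η < ∣ b ∣
    near-far a b η big near = ℚ.≰⇒> λ small → ℚ.<-irrefl ≡.refl (begin-strict
      ∣ a ∣              ≡⟨ ≡.cong ∣_∣ (solve 2 (λ a b → a := (a :- b) :+ b) ≡.refl a b) ⟩
      ∣ (a - b) + b ∣    ≤⟨ ℚ.∣p+q∣≤∣p∣+∣q∣ (a - b) b ⟩
      ∣ a - b ∣ + ∣ b ∣  <⟨ ℚ.+-mono-<-≤ near small ⟩
      η + η              ≤⟨ big ⟩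
      ∣ a ∣              ∎)
      where
      open ℚ.≤-Reasoning
      open +-*-Solver

    away : ∀ (u : ℝ) {θ} N →
      (∀ i j → N ℕ.≤ i → N ℕ.≤ j → ∣ seq u i - seq u j ∣ < ½ * θ) →
      θ ≤ ∣ seq u N ∣ → Eventually (λ n → ½ * θ < ∣ seq u n ∣)
    away u {θ} N c big = N , λ n le → near-far (seq u N) (seq u n) (½ * θ)
      (≡.subst (_≤ ∣ seq u N ∣) (≡.sym (half+half θ)) big) (c N n ℕ.≤-refl le)

  #-cotrans : ∀ {x y} → x # y → ∀ z → (x # z) ⊎ (z # y)
  #-cotrans {x} {y} (mk# (ε , 0<ε , F , far)) z =
    let θ = ½ * ε
        0<θ = 0<half 0<ε
        u = x ⊕ ⊖ z
        v = z ⊕ ⊖ y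
        (M₁ , p) = cauchy u (½ * θ) (0<half 0<θ)
        (M₂ , q) = cauchy v (½ * θ) (0<half 0<θ)
        N = F ℕ.⊔ (M₁ ℕ.⊔ M₂)
    in map⊎ mk# mk# (decide θ 0<θ u v
         N
         (λ i j li lj → p i j (ℕ.≤-trans (le₁ M₁ M₂) li) (ℕ.≤-trans (le₁ M₁ M₂) lj))
         (λ i j li lj → q i j (ℕ.≤-trans (le₂ M₁ M₂) li) (ℕ.≤-trans (le₂ M₁ M₂) lj))
         (ℚ.<-≤-trans (≡.subst (λ r → r < ∣ seq x N - seq y N ∣) (≡.sym (half+half ε)) (far N (ℕ.m≤m⊔n F (M₁ ℕ.⊔ M₂))))
           (abs-tri (seq x N) (seq z N) (seq y N))))
    where
    le₁ : ∀ M₁ M₂ → M₁ ℕ.≤ F ℕ.⊔ (M₁ ℕ.⊔ M₂)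
    le₁ M₁ M₂ = ℕ.≤-trans (ℕ.m≤m⊔n M₁ M₂) (ℕ.m≤n⊔m F (M₁ ℕ.⊔ M₂))
    le₂ : ∀ M₁ M₂ → M₂ ℕ.≤ F ℕ.⊔ (M₁ ℕ.⊔ M₂)
    le₂ M₁ M₂ = ℕ.≤-trans (ℕ.m≤n⊔m M₁ M₂) (ℕ.m≤n⊔m F (M₁ ℕ.⊔ M₂))
    decide : ∀ θ → 0ℚ < θ → (u v : ℝ) (N : ℕ) →
      (∀ i j → N ℕ.≤ i → N ℕ.≤ j → ∣ seq u i - seq u j ∣ < ½ * θ) →
      (∀ i j → N ℕ.≤ i → N ℕ.≤ j → ∣ seq v i - seq v j ∣ < ½ * θ) →
      θ + θ < ∣ seq u N ∣ + ∣ seq v N ∣ →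
      AwayFromZero (seq u) ⊎ AwayFromZero (seq v)
    decide θ 0<θ u v N p q big with θ ℚ.≤? ∣ seq u N ∣
    ... | yes large = inj₁ (½ * θ , 0<half 0<θ , away u N p large)
    ... | no ¬large = inj₂ (½ * θ , 0<half 0<θ , away v N q
      (ℚ.≮⇒≥ λ small → ℚ.<-asym big (ℚ.+-mono-< (ℚ.≰⇒> ¬large) small)))

  #-tight : ∀ x y → (¬ (x # y) → x ≈ y) × (x ≈ y → ¬ (x # y))
  #-tight x y = to , #-irrefl
    where
    u = x ⊕ ⊖ y
    to : ¬ (x # y) → x ≈ y
    to ¬x#y = mk≈ λ ε 0<ε → nearby ε 0<ε
      where
      nearby : ∀ ε → 0ℚ < ε → Eventually (λ n → ∣ seq u n ∣ < ε)
      nearby ε 0<ε with cauchy u (½ * (½ * ε)) (0<half (0<half 0<ε)) | cauchy u (½ * ε) (0<half 0<ε)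
      ... | M₁ , p | M₂ , q with ½ * ε ℚ.≤? ∣ seq u (M₁ ℕ.⊔ M₂) ∣
      ... | yes large = contradiction
        (mk# (½ * (½ * ε) , 0<half (0<half 0<ε) ,
          away u (M₁ ℕ.⊔ M₂) (λ i j li lj → p i j (ℕ.≤-trans (ℕ.m≤m⊔n M₁ M₂) li) (ℕ.≤-trans (ℕ.m≤m⊔n M₁ M₂) lj)) large))
        ¬x#y
      ... | no ¬large = M₁ ℕ.⊔ M₂ , λ n le → ≡.subst (λ z → ∣ z ∣ < ε) (ℚ.+-identityʳ (seq u n))
        (tri-< (seq u n) (seq u (M₁ ℕ.⊔ M₂)) 0ℚ ε
          (q n (M₁ ℕ.⊔ M₂) (ℕ.≤-trans (ℕ.m≤n⊔m M₁ M₂) le) (ℕ.m≤n⊔m M₁ M₂))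
          (≡.subst (λ z → ∣ z ∣ < ½ * ε) (≡.sym (ℚ.+-identityʳ (seq u (M₁ ℕ.⊔ M₂)))) (ℚ.≰⇒> ¬large)))

  -- Junk value 0 at 0, met only finitely often when x # 0.
  inv : ℚ → ℚ
  inv p with p ℚ.≟ 0ℚ
  ... | yes _   = 0ℚ
  ... | no  p≢0 = (ℚ.1/ p) {{ℚ.≢-nonZero p≢0}}

  private
    inv-inverse : ∀ p {ε} → 0ℚ < ε → ε < ∣ p ∣ → p * inv p ≡ 1ℚ
    inv-inverse p 0<ε far with p ℚ.≟ 0ℚ
    ... | yes ≡.refl = contradiction (ℚ.<-trans 0<ε far) (ℚ.<-irrefl ≡.refl)
    ... | no  p≢0    = ℚ.*-inverseʳ p {{ℚ.≢-nonZero p≢0}}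

    inv-bound : ∀ p {ε C} → 0ℚ < ε → 0ℚ < C → ε < ∣ p ∣ → ε * C ≡ 1ℚ → ∣ inv p ∣ ≤ C
    inv-bound p {ε} {C} 0<ε 0<C far εC = begin
      ∣ inv p ∣              ≡⟨ ℚ.*-identityʳ ∣ inv p ∣ ⟨
      ∣ inv p ∣ * 1ℚ         ≡⟨ ≡.cong (∣ inv p ∣ *_) εC ⟨
      ∣ inv p ∣ * (ε * C)    ≡⟨ solve 3 (λ a b c → a :* (b :* c) := (b :* a) :* c) ≡.refl ∣ inv p ∣ ε C ⟩
      (ε * ∣ inv p ∣) * C    ≤⟨ ℚ.*-monoʳ-≤-nonNeg C {{ℚ.nonNegative (ℚ.<⇒≤ 0<C)}}
                                 (ℚ.*-monoʳ-≤-nonNeg ∣ inv p ∣ {{ℚ.∣-∣-nonNeg (inv p)}} (ℚ.<⇒≤ far)) ⟩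
      (∣ p ∣ * ∣ inv p ∣) * C ≡⟨ ≡.cong (_* C) (ℚ.∣p*q∣≡∣p∣*∣q∣ p (inv p)) ⟨
      ∣ p * inv p ∣ * C      ≡⟨ ≡.cong (λ z → ∣ z ∣ * C) (inv-inverse p 0<ε far) ⟩
      1ℚ * C                 ≡⟨ ℚ.*-identityˡ C ⟩
      C                      ∎
      where
      open ℚ.≤-Reasoning
      open +-*-Solver

    inv-diff : ∀ a b → a * inv a ≡ 1ℚ → b * inv b ≡ 1ℚ →
      (inv a * inv b) * (b - a) ≡ inv a - inv b
    inv-diff a b aa bb = begin
      (inv a * inv b) * (b - a)
        ≡⟨ solve 4 (λ a b i j → (i :* j) :* (b :- a) := i :* (b :* j) :- j :* (a :* i)) ≡.refl a b (inv a) (inv b) ⟩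
      inv a * (b * inv b) - inv b * (a * inv a)
        ≡⟨ ≡.cong₂ (λ s t → inv a * s - inv b * t) bb aa ⟩
      inv a * 1ℚ - inv b * 1ℚ
        ≡⟨ ≡.cong₂ _-_ (ℚ.*-identityʳ (inv a)) (ℚ.*-identityʳ (inv b)) ⟩
      inv a - inv b ∎
      where
      open ≡.≡-Reasoning
      open +-*-Solver

    inv-< : ∀ a b {ε C δ η} → 0ℚ < ε → 0ℚ < C → 0ℚ < δ → ε * C ≡ 1ℚ →
      ε < ∣ a ∣ → ε < ∣ b ∣ → (C * C) * δ ≡ η → ∣ a - b ∣ < δ → ∣ inv a - inv b ∣ < η
    inv-< a b {ε} {C} {δ} {η} 0<ε 0<C 0<δ εC fa fb Cδ ab = begin-strict
      ∣ inv a - inv b ∣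
        ≡⟨ ≡.cong ∣_∣ (inv-diff a b (inv-inverse a 0<ε fa) (inv-inverse b 0<ε fb)) ⟨
      ∣ (inv a * inv b) * (b - a) ∣
        ≡⟨ ℚ.∣p*q∣≡∣p∣*∣q∣ (inv a * inv b) (b - a) ⟩
      ∣ inv a * inv b ∣ * ∣ b - a ∣
        ≡⟨ ≡.cong₂ _*_ (ℚ.∣p*q∣≡∣p∣*∣q∣ (inv a) (inv b)) (abs-sym b a) ⟩
      (∣ inv a ∣ * ∣ inv b ∣) * ∣ a - b ∣
        ≤⟨ ℚ.*-monoʳ-≤-nonNeg ∣ a - b ∣ {{ℚ.∣-∣-nonNeg (a - b)}}
             (mono-≤ (ℚ.0≤∣p∣ (inv b)) (ℚ.<⇒≤ 0<C) (inv-bound a 0<ε 0<C fa εC) (inv-bound b 0<ε 0<C fb εC)) ⟩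
      (C * C) * ∣ a - b ∣
        <⟨ ℚ.*-monoʳ-<-pos (C * C) {{ℚ.positive (0<* 0<C 0<C)}} ab ⟩
      (C * C) * δ
        ≡⟨ Cδ ⟩
      η ∎
      where open ℚ.≤-Reasoning

  private abstract
    reciprocal-cauchy : ∀ u → AwayFromZero (seq u) → IsCauchy (λ n → inv (seq u n))
    reciprocal-cauchy u (ε , 0<ε , F , far) η 0<η =
      let (C , 0<C , εC) = scaleDown ε 1ℚ 0<ε 0<1
          (δ , 0<δ , Cδ) = scaleDown (C * C) η (0<* 0<C 0<C) 0<η
          (M , p) = cauchy u δ 0<δ
      in F ℕ.⊔ M , λ i j li lj → inv-< (seq u i) (seq u j) 0<ε 0<C 0<δ εC
           (far i (ℕ.≤-trans (ℕ.m≤m⊔n F M) li)) (far j (ℕ.≤-trans (ℕ.m≤m⊔n F M) lj)) Cδ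
           (p i j (ℕ.≤-trans (ℕ.m≤n⊔m F M) li) (ℕ.≤-trans (ℕ.m≤n⊔m F M) lj))

  reciprocal : ∀ u → AwayFromZero (seq u) → ℝ
  reciprocal u u#0 = mkℝ (λ n → inv (seq u n)) (reciprocal-cauchy u u#0)

  reciprocal-inverse : ∀ u u#0 → u · reciprocal u u#0 ≈ fromℚ 1ℚ
  reciprocal-inverse u (ε , 0<ε , F , far) = mk≈ λ η 0<η → F , λ n le →
    ≡.subst (_< η)
      (≡.sym (≡.cong ∣_∣ (≡.trans (≡.cong (λ z → z - 1ℚ) (inv-inverse (seq u n) 0<ε (far n le))) (ℚ.+-inverseʳ 1ℚ)))) 0<η

  private
    factor-away : ∀ a b ε B h → 0ℚ < ε → ∣ b ∣ < B → B * ε ≡ h → h < ∣ a * b ∣ → ε < ∣ a ∣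
    factor-away a b ε B h 0<ε bB Bε far = ℚ.≰⇒> λ small → ℚ.<-irrefl ≡.refl (begin-strict
      h              <⟨ far ⟩
      ∣ a * b ∣      ≡⟨ ℚ.∣p*q∣≡∣p∣*∣q∣ a b ⟩
      ∣ a ∣ * ∣ b ∣  ≤⟨ mono-≤ (ℚ.0≤∣p∣ b) (ℚ.<⇒≤ 0<ε) small (ℚ.<⇒≤ bB) ⟩
      ε * B          ≡⟨ ℚ.*-comm ε B ⟩
      B * ε          ≡⟨ Bε ⟩
      h              ∎)
      where open ℚ.≤-Reasoning

    ½+½≤∣1∣ : ½ + ½ ≤ ∣ 1ℚ ∣
    ½+½≤∣1∣ = ℚ.≤-reflexive ≡.refl

    unit⇒away : ∀ u w → u · w ≈ fromℚ 1ℚ → AwayFromZero (seq u)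
    unit⇒away u w (mk≈ uw≈1) =
      let (B , 0<B , bw) = bounded w
          (ε , 0<ε , Bε) = scaleDown B ½ 0<B 0<½
      in ε , 0<ε , ev-map
           (λ n (near , wB) → factor-away (seq u n) (seq w n) ε B ½ 0<ε wB Bε
             (near-far 1ℚ (seq u n * seq w n) ½ ½+½≤∣1∣
               (≡.subst (_< ½) (abs-sym (seq u n * seq w n) 1ℚ) near)))
           (uw≈1 ½ 0<½ ∧ bw)

  heytingField : HeytingField 0ℓ 0ℓ 0ℓ
  heytingField = record
    { Carrier = ℝ ; _≈_ = _≈_ ; _#_ = _#_ ; _+_ = _⊕_ ; _*_ = _·_ ; -_ = ⊖_
    ; 0# = fromℚ 0ℚ ; 1# = fromℚ 1ℚ
    ; isHeytingField = record
      { isHeytingCommutativeRing = record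
        { isCommutativeRing = CommutativeRing.isCommutativeRing commutativeRing
        ; isApartnessRelation = record
          { irrefl  = #-irrefl
          ; sym     = #-sym
          ; cotrans = #-cotrans
          }
        ; #⇒invertible = λ {x} {y} (mk# x#y) →
            let u = x ⊕ ⊖ y
                w = reciprocal u x#y
                uw≈1 = reciprocal-inverse u x#y
            in w , ≈-trans (≗⇒≈ λ n → ℚ.*-comm (seq w n) (seq u n)) uw≈1 , uw≈1
        ; invertible⇒# = λ {x} {y} (w , _ , uw≈1) → mk# (unit⇒away (x ⊕ ⊖ y) w uw≈1)
        }
      ; tight = #-tight
      }
    }

record Algebra {c ℓ} (R : CommutativeRing c ℓ) a ℓa : Set (c ⊔ ℓ ⊔ lsuc (a ⊔ ℓa)) where
  private module R = CommutativeRing R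
  infixr 7 _•_
  field
    ring : Ring a ℓa
  open Ring ring public
  field
    _•_          : R.Carrier → Carrier → Carrier
    isLeftModule : IsLeftModule R.ring _≈_ _+_ 0# -_ _•_
    •-*-assocˡ   : ∀ r x y → (r • x) * y ≈ r • (x * y)
    •-*-assocʳ   : ∀ r x y → x * (r • y) ≈ r • (x * y)
  open IsLeftModule isLeftModule public
    using (*ₗ-cong; *ₗ-congˡ; *ₗ-congʳ; *ₗ-zeroˡ; *ₗ-zeroʳ; *ₗ-identityˡ; *ₗ-assoc; *ₗ-distribˡ; *ₗ-distribʳ)
  open MonoidSum +-monoid public using (sum)

record IsAlgebraHomomorphism {c ℓ} {R : CommutativeRing c ℓ} {a ℓa b ℓb}
    (A : Algebra R a ℓa) (B : Algebra R b ℓb)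
    (f : Algebra.Carrier A → Algebra.Carrier B) : Set (c ⊔ a ⊔ ℓa ⊔ ℓb) where
  private
    module A = Algebra A
    module B = Algebra B
  field
    isRingHomomorphism : IsRingHomomorphism (Ring.rawRing A.ring) (Ring.rawRing B.ring) f
    •-homo             : ∀ r x → f (r A.• x) B.≈ r B.• f x
  open IsRingHomomorphism isRingHomomorphism public

record AlgebraHomomorphism {c ℓ} {R : CommutativeRing c ℓ} {a ℓa b ℓb}
    (A : Algebra R a ℓa) (B : Algebra R b ℓb) : Set (c ⊔ a ⊔ ℓa ⊔ b ⊔ ℓb) where
  field
    ⟦_⟧                   : Algebra.Carrier A → Algebra.Carrier B
    isAlgebraHomomorphism : IsAlgebraHomomorphism A B ⟦_⟧
  open IsAlgebraHomomorphism isAlgebraHomomorphism public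

-- The algebra generated by X subject to given relations: terms modulo the
-- least congruence that satisfies the algebra laws and the relations.
module Presentation {c ℓ} (R : CommutativeRing c ℓ) {x} (X : Set x) where
  private module R = CommutativeRing R
  infix  8 -_
  infixl 7 _*_
  infixr 7 _•_
  infixl 6 _+_

  data Term : Set (c ⊔ x) where
    gen     : X → Term
    0# 1#   : Term
    -_      : Term → Term
    _+_ _*_ : Term → Term → Term
    _•_     : R.Carrier → Term → Term

  module Quotient {r} (Relator : Term → Term → Set r) where
    infix 4 _~_

    data _~_ : Term → Term → Set (c ⊔ ℓ ⊔ x ⊔ r) where
      relator : ∀ {s t} → Relator s t → s ~ t
      ~-refl  : ∀ {s} → s ~ s
      ~-sym   : ∀ {s t} → s ~ t → t ~ s
      ~-trans : ∀ {s t u} → s ~ t → t ~ u → s ~ u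
      +-cong  : ∀ {s s′ t t′} → s ~ s′ → t ~ t′ → s + t ~ s′ + t′
      *-cong  : ∀ {s s′ t t′} → s ~ s′ → t ~ t′ → s * t ~ s′ * t′
      -‿cong  : ∀ {s t} → s ~ t → - s ~ - t
      •-cong  : ∀ {k l s t} → k R.≈ l → s ~ t → k • s ~ l • t
      +-assoc     : ∀ s t u → (s + t) + u ~ s + (t + u)
      +-comm      : ∀ s t → s + t ~ t + s
      +-identityˡ : ∀ s → 0# + s ~ s
      -‿inverseˡ  : ∀ s → - s + s ~ 0#
      *-assoc     : ∀ s t u → (s * t) * u ~ s * (t * u)
      *-identityˡ : ∀ s → 1# * s ~ s
      *-identityʳ : ∀ s → s * 1# ~ s
      distribˡ    : ∀ s t u → s * (t + u) ~ s * t + s * u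
      distribʳ    : ∀ s t u → (t + u) * s ~ t * s + u * s
      •-identityˡ : ∀ s → R.1# • s ~ s
      •-assoc     : ∀ k l s → (k R.* l) • s ~ k • (l • s)
      •-distribˡ  : ∀ k s t → k • (s + t) ~ k • s + k • t
      •-distribʳ  : ∀ s k l → (k R.+ l) • s ~ k • s + l • s
      •-*-assocˡ  : ∀ k s t → (k • s) * t ~ k • (s * t)
      •-*-assocʳ  : ∀ k s t → s * (k • t) ~ k • (s * t)

    setoid : Setoid (c ⊔ x) (c ⊔ ℓ ⊔ x ⊔ r)
    setoid = record
      { Carrier = Term ; _≈_ = _~_
      ; isEquivalence = record { refl = ~-refl ; sym = ~-sym ; trans = ~-trans }
      }

    private
      open import Algebra.Consequences.Setoid setoid

      abelianGroup : AbelianGroup (c ⊔ x) (c ⊔ ℓ ⊔ x ⊔ r)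
      abelianGroup = record
        { Carrier = Term ; _≈_ = _~_ ; _∙_ = _+_ ; ε = 0# ; _⁻¹ = -_
        ; isAbelianGroup = record
          { isGroup = record
            { isMonoid = record
              { isSemigroup = record
                { isMagma = record { isEquivalence = Setoid.isEquivalence setoid ; ∙-cong = +-cong }
                ; assoc = +-assoc
                }
              ; identity = comm∧idˡ⇒id +-comm +-identityˡ
              }
            ; inverse = comm∧invˡ⇒inv +-comm -‿inverseˡ
            ; ⁻¹-cong = -‿cong
            }
          ; comm = +-comm
          }
        }
      module G = AbelianGroup abelianGroup
      open AbelianGroupProperties abelianGroup using (identityʳ-unique)

      •-zeroˡ : ∀ s → R.0# • s ~ 0#
      •-zeroˡ s = identityʳ-unique (R.0# • s) (R.0# • s)
        (~-trans (~-sym (•-distribʳ s R.0# R.0#)) (•-cong (R.+-identityˡ R.0#) ~-refl))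

      •-zeroʳ : ∀ k → k • 0# ~ 0#
      •-zeroʳ k = identityʳ-unique (k • 0#) (k • 0#)
        (~-trans (~-sym (•-distribˡ k 0# 0#)) (•-cong R.refl (+-identityˡ 0#)))

    algebra : Algebra R (c ⊔ x) (c ⊔ ℓ ⊔ x ⊔ r)
    algebra = record
      { ring = record
        { Carrier = Term ; _≈_ = _~_ ; _+_ = _+_ ; _*_ = _*_ ; -_ = -_ ; 0# = 0# ; 1# = 1#
        ; isRing = record
          { +-isAbelianGroup = G.isAbelianGroup
          ; *-cong     = *-cong
          ; *-assoc    = *-assoc
          ; *-identity = *-identityˡ , *-identityʳ
          ; distrib    = distribˡ , distribʳ
          }
        }
      ; _•_ = _•_
      ; isLeftModule = record
        { isLeftSemimodule = record
          { +ᴹ-isCommutativeMonoid = G.isCommutativeMonoid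
          ; isPreleftSemimodule = record
            { *ₗ-cong      = •-cong
            ; *ₗ-zeroˡ     = •-zeroˡ
            ; *ₗ-distribʳ  = •-distribʳ
            ; *ₗ-identityˡ = •-identityˡ
            ; *ₗ-assoc     = •-assoc
            ; *ₗ-zeroʳ     = •-zeroʳ
            ; *ₗ-distribˡ  = •-distribˡ
            }
          }
        ; -ᴹ‿cong    = -‿cong
        ; -ᴹ‿inverse = G.inverse
        }
      ; •-*-assocˡ = •-*-assocˡ
      ; •-*-assocʳ = •-*-assocʳ
      }

module Clifford {c ℓ} (R : CommutativeRing c ℓ) (r : ℕ) where
  open Presentation R (Fin r) public using (Term; gen; 1#; _*_; -_)

  data Relator : Term → Term → Set c where
    square      : ∀ i → Relator (gen i * gen i) 1#
    anticommute : ∀ {i j} → i ≢ j → Relator (gen i * gen j) (- (gen j * gen i))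

  algebra : Algebra R c (c ⊔ ℓ)
  algebra = Presentation.Quotient.algebra R (Fin r) Relator

-- The ungraded tensor product: the free abelian group on symbols x ⊗ y modulo
-- biadditivity and balancedness, with (x ⊗ y)(x′ ⊗ y′) = xx′ ⊗ yy′.
module TensorProduct {c ℓ a ℓa b ℓb} (R : CommutativeRing c ℓ)
    (A : Algebra R a ℓa) (B : Algebra R b ℓb) where
  private
    module R = CommutativeRing R
    module A = Algebra A
    module B = Algebra B
  infix  8 -_
  infixl 7 _⊗_ _*_
  infixr 7 _•_
  infixl 6 _+_
  infix  4 _~_

  data Tensor : Set (a ⊔ b) where
    _⊗_ : A.Carrier → B.Carrier → Tensor
    0#  : Tensor
    _+_ : Tensor → Tensor → Tensor
    -_  : Tensor → Tensor

  data _~_ : Tensor → Tensor → Set (c ⊔ a ⊔ ℓa ⊔ b ⊔ ℓb) where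
    ~-refl      : ∀ {s} → s ~ s
    ~-sym       : ∀ {s t} → s ~ t → t ~ s
    ~-trans     : ∀ {s t u} → s ~ t → t ~ u → s ~ u
    +-cong      : ∀ {s s′ t t′} → s ~ s′ → t ~ t′ → s + t ~ s′ + t′
    -‿cong      : ∀ {s t} → s ~ t → - s ~ - t
    +-assoc     : ∀ s t u → (s + t) + u ~ s + (t + u)
    +-comm      : ∀ s t → s + t ~ t + s
    +-identityˡ : ∀ s → 0# + s ~ s
    -‿inverseˡ  : ∀ s → - s + s ~ 0#
    ⊗-cong      : ∀ {x x′ y y′} → x A.≈ x′ → y B.≈ y′ → x ⊗ y ~ x′ ⊗ y′
    ⊗-distribˡ  : ∀ x y y′ → x ⊗ (y B.+ y′) ~ x ⊗ y + x ⊗ y′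
    ⊗-distribʳ  : ∀ x x′ y → (x A.+ x′) ⊗ y ~ x ⊗ y + x′ ⊗ y
    ⊗-balanced  : ∀ k x y → (k A.• x) ⊗ y ~ x ⊗ (k B.• y)

  _•_ : R.Carrier → Tensor → Tensor
  k • (x ⊗ y) = (k A.• x) ⊗ y
  k • 0#      = 0#
  k • (s + t) = k • s + k • t
  k • (- s)   = - (k • s)

  1# : Tensor
  1# = A.1# ⊗ B.1#

  mulPure : A.Carrier → B.Carrier → Tensor → Tensor
  mulPure x y (x′ ⊗ y′) = (x A.* x′) ⊗ (y B.* y′)
  mulPure x y 0#        = 0#
  mulPure x y (s + t)   = mulPure x y s + mulPure x y t
  mulPure x y (- s)     = - mulPure x y s

  _*_ : Tensor → Tensor → Tensor
  (x ⊗ y) * t = mulPure x y t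
  0#      * t = 0#
  (s + u) * t = s * t + u * t
  (- s)   * t = - (s * t)

  setoid : Setoid (a ⊔ b) (c ⊔ a ⊔ ℓa ⊔ b ⊔ ℓb)
  setoid = record
    { Carrier = Tensor ; _≈_ = _~_
    ; isEquivalence = record { refl = ~-refl ; sym = ~-sym ; trans = ~-trans }
    }

  private
    open import Algebra.Consequences.Setoid setoid
    open SetoidReasoning setoid

    abelianGroup : AbelianGroup (a ⊔ b) (c ⊔ a ⊔ ℓa ⊔ b ⊔ ℓb)
    abelianGroup = record
      { Carrier = Tensor ; _≈_ = _~_ ; _∙_ = _+_ ; ε = 0# ; _⁻¹ = -_
      ; isAbelianGroup = record
        { isGroup = record
          { isMonoid = record
            { isSemigroup = record
              { isMagma = record { isEquivalence = Setoid.isEquivalence setoid ; ∙-cong = +-cong }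
              ; assoc = +-assoc
              }
            ; identity = comm∧idˡ⇒id +-comm +-identityˡ
            }
          ; inverse = comm∧invˡ⇒inv +-comm -‿inverseˡ
          ; ⁻¹-cong = -‿cong
          }
        ; comm = +-comm
        }
      }
    module G = AbelianGroup abelianGroup
    open AbelianGroupProperties abelianGroup
      using (identityʳ-unique; ⁻¹-∙-comm; ε⁻¹≈ε)
    open import Algebra.Properties.CommutativeSemigroup G.commutativeSemigroup
      using (interchange)

    ⊗-zeroˡ : ∀ y → A.0# ⊗ y ~ 0#
    ⊗-zeroˡ y = identityʳ-unique (A.0# ⊗ y) (A.0# ⊗ y)
      (~-trans (~-sym (⊗-distribʳ A.0# A.0# y)) (⊗-cong (A.+-identityˡ A.0#) B.refl))

    neg-+ : ∀ s t → - (s + t) ~ - s + - t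
    neg-+ s t = ~-sym (⁻¹-∙-comm s t)

    neg-0 : - 0# ~ 0#
    neg-0 = ε⁻¹≈ε

    swap : ∀ s t u v → (s + t) + (u + v) ~ (s + u) + (t + v)
    swap = interchange

    swap-• : ∀ k l x → k A.• (l A.• x) A.≈ l A.• (k A.• x)
    swap-• k l x = A.trans (A.sym (A.*ₗ-assoc k l x))
      (A.trans (A.*ₗ-congʳ (R.*-comm k l)) (A.*ₗ-assoc l k x))

    •-congʳ : ∀ {k l} → k R.≈ l → ∀ t → k • t ~ l • t
    •-congʳ e (x ⊗ y) = ⊗-cong (A.*ₗ-congʳ e) B.refl
    •-congʳ e 0#      = ~-refl
    •-congʳ e (s + t) = +-cong (•-congʳ e s) (•-congʳ e t)
    •-congʳ e (- s)   = -‿cong (•-congʳ e s)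

    •-congˡ : ∀ k {s t} → s ~ t → k • s ~ k • t
    •-congˡ k ~-refl = ~-refl
    •-congˡ k (~-sym p) = ~-sym (•-congˡ k p)
    •-congˡ k (~-trans p q) = ~-trans (•-congˡ k p) (•-congˡ k q)
    •-congˡ k (+-cong p q) = +-cong (•-congˡ k p) (•-congˡ k q)
    •-congˡ k (-‿cong p) = -‿cong (•-congˡ k p)
    •-congˡ k (+-assoc s t u) = +-assoc _ _ _
    •-congˡ k (+-comm s t) = +-comm _ _
    •-congˡ k (+-identityˡ s) = +-identityˡ _
    •-congˡ k (-‿inverseˡ s) = -‿inverseˡ _
    •-congˡ k (⊗-cong p q) = ⊗-cong (A.*ₗ-congˡ p) q
    •-congˡ k (⊗-distribˡ x y y′) = ⊗-distribˡ _ y y′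
    •-congˡ k (⊗-distribʳ x x′ y) =
      ~-trans (⊗-cong (A.*ₗ-distribˡ k x x′) B.refl) (⊗-distribʳ _ _ y)
    •-congˡ k (⊗-balanced l x y) =
      ~-trans (⊗-cong (swap-• k l x) B.refl) (⊗-balanced l _ y)

    •-identityˡ : ∀ t → R.1# • t ~ t
    •-identityˡ (x ⊗ y) = ⊗-cong (A.*ₗ-identityˡ x) B.refl
    •-identityˡ 0#      = ~-refl
    •-identityˡ (s + t) = +-cong (•-identityˡ s) (•-identityˡ t)
    •-identityˡ (- s)   = -‿cong (•-identityˡ s)

    •-zeroˡ : ∀ t → R.0# • t ~ 0#
    •-zeroˡ (x ⊗ y) = ~-trans (⊗-cong (A.*ₗ-zeroˡ x) B.refl) (⊗-zeroˡ y)
    •-zeroˡ 0#      = ~-refl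
    •-zeroˡ (s + t) = ~-trans (+-cong (•-zeroˡ s) (•-zeroˡ t)) (+-identityˡ 0#)
    •-zeroˡ (- s)   = ~-trans (-‿cong (•-zeroˡ s)) neg-0

    •-assoc : ∀ k l t → (k R.* l) • t ~ k • (l • t)
    •-assoc k l (x ⊗ y) = ⊗-cong (A.*ₗ-assoc k l x) B.refl
    •-assoc k l 0#      = ~-refl
    •-assoc k l (s + t) = +-cong (•-assoc k l s) (•-assoc k l t)
    •-assoc k l (- s)   = -‿cong (•-assoc k l s)

    •-distribʳ : ∀ t k l → (k R.+ l) • t ~ k • t + l • t
    •-distribʳ (x ⊗ y) k l = ~-trans (⊗-cong (A.*ₗ-distribʳ x k l) B.refl) (⊗-distribʳ _ _ y)
    •-distribʳ 0#      k l = ~-sym (+-identityˡ 0#)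
    •-distribʳ (s + t) k l = ~-trans (+-cong (•-distribʳ s k l) (•-distribʳ t k l)) (swap _ _ _ _)
    •-distribʳ (- s)   k l = ~-trans (-‿cong (•-distribʳ s k l)) (neg-+ _ _)

    mulPure-cong : ∀ {x x′ y y′} → x A.≈ x′ → y B.≈ y′ → ∀ t → mulPure x y t ~ mulPure x′ y′ t
    mulPure-cong p q (x ⊗ y) = ⊗-cong (A.*-congʳ p) (B.*-congʳ q)
    mulPure-cong p q 0#      = ~-refl
    mulPure-cong p q (s + t) = +-cong (mulPure-cong p q s) (mulPure-cong p q t)
    mulPure-cong p q (- s)   = -‿cong (mulPure-cong p q s)

    mulPure-distribˡ : ∀ x y y′ t → mulPure x (y B.+ y′) t ~ mulPure x y t + mulPure x y′ t
    mulPure-distribˡ x y y′ (u ⊗ v) =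
      ~-trans (⊗-cong A.refl (B.distribʳ v y y′)) (⊗-distribˡ _ _ _)
    mulPure-distribˡ x y y′ 0#      = ~-sym (+-identityˡ 0#)
    mulPure-distribˡ x y y′ (s + t) =
      ~-trans (+-cong (mulPure-distribˡ x y y′ s) (mulPure-distribˡ x y y′ t)) (swap _ _ _ _)
    mulPure-distribˡ x y y′ (- s)   = ~-trans (-‿cong (mulPure-distribˡ x y y′ s)) (neg-+ _ _)

    mulPure-distribʳ : ∀ x x′ y t → mulPure (x A.+ x′) y t ~ mulPure x y t + mulPure x′ y t
    mulPure-distribʳ x x′ y (u ⊗ v) =
      ~-trans (⊗-cong (A.distribʳ u x x′) B.refl) (⊗-distribʳ _ _ _)
    mulPure-distribʳ x x′ y 0#      = ~-sym (+-identityˡ 0#)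
    mulPure-distribʳ x x′ y (s + t) =
      ~-trans (+-cong (mulPure-distribʳ x x′ y s) (mulPure-distribʳ x x′ y t)) (swap _ _ _ _)
    mulPure-distribʳ x x′ y (- s)   = ~-trans (-‿cong (mulPure-distribʳ x x′ y s)) (neg-+ _ _)

    mulPure-balanced : ∀ k x y t → mulPure (k A.• x) y t ~ mulPure x (k B.• y) t
    mulPure-balanced k x y (u ⊗ v) = ~-trans (⊗-cong (A.•-*-assocˡ k x u) B.refl)
      (~-trans (⊗-balanced k _ _) (⊗-cong A.refl (B.sym (B.•-*-assocˡ k y v))))
    mulPure-balanced k x y 0#      = ~-refl
    mulPure-balanced k x y (s + t) = +-cong (mulPure-balanced k x y s) (mulPure-balanced k x y t)
    mulPure-balanced k x y (- s)   = -‿cong (mulPure-balanced k x y s)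

    mulPure-congˡ : ∀ x y {s t} → s ~ t → mulPure x y s ~ mulPure x y t
    mulPure-congˡ x y ~-refl = ~-refl
    mulPure-congˡ x y (~-sym p) = ~-sym (mulPure-congˡ x y p)
    mulPure-congˡ x y (~-trans p q) = ~-trans (mulPure-congˡ x y p) (mulPure-congˡ x y q)
    mulPure-congˡ x y (+-cong p q) = +-cong (mulPure-congˡ x y p) (mulPure-congˡ x y q)
    mulPure-congˡ x y (-‿cong p) = -‿cong (mulPure-congˡ x y p)
    mulPure-congˡ x y (+-assoc s t u) = +-assoc _ _ _
    mulPure-congˡ x y (+-comm s t) = +-comm _ _
    mulPure-congˡ x y (+-identityˡ s) = +-identityˡ _
    mulPure-congˡ x y (-‿inverseˡ s) = -‿inverseˡ _
    mulPure-congˡ x y (⊗-cong p q) = ⊗-cong (A.*-congˡ p) (B.*-congˡ q)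
    mulPure-congˡ x y (⊗-distribˡ u v v′) =
      ~-trans (⊗-cong A.refl (B.distribˡ y v v′)) (⊗-distribˡ _ _ _)
    mulPure-congˡ x y (⊗-distribʳ u u′ v) =
      ~-trans (⊗-cong (A.distribˡ x u u′) B.refl) (⊗-distribʳ _ _ _)
    mulPure-congˡ x y (⊗-balanced k u v) = ~-trans (⊗-cong (A.•-*-assocʳ k x u) B.refl)
      (~-trans (⊗-balanced k _ _) (⊗-cong A.refl (B.sym (B.•-*-assocʳ k y v))))

    *-congˡ : ∀ s {t u} → t ~ u → s * t ~ s * u
    *-congˡ (x ⊗ y) p = mulPure-congˡ x y p
    *-congˡ 0#      p = ~-refl
    *-congˡ (s + t) p = +-cong (*-congˡ s p) (*-congˡ t p)
    *-congˡ (- s)   p = -‿cong (*-congˡ s p)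

    *-congʳ : ∀ {s u} t → s ~ u → s * t ~ u * t
    *-congʳ t ~-refl = ~-refl
    *-congʳ t (~-sym p) = ~-sym (*-congʳ t p)
    *-congʳ t (~-trans p q) = ~-trans (*-congʳ t p) (*-congʳ t q)
    *-congʳ t (+-cong p q) = +-cong (*-congʳ t p) (*-congʳ t q)
    *-congʳ t (-‿cong p) = -‿cong (*-congʳ t p)
    *-congʳ t (+-assoc s u v) = +-assoc _ _ _
    *-congʳ t (+-comm s u) = +-comm _ _
    *-congʳ t (+-identityˡ s) = +-identityˡ _
    *-congʳ t (-‿inverseˡ s) = -‿inverseˡ _
    *-congʳ t (⊗-cong p q) = mulPure-cong p q t
    *-congʳ t (⊗-distribˡ x y y′) = mulPure-distribˡ x y y′ t
    *-congʳ t (⊗-distribʳ x x′ y) = mulPure-distribʳ x x′ y t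
    *-congʳ t (⊗-balanced k x y) = mulPure-balanced k x y t

    *-distribˡ : ∀ s t u → s * (t + u) ~ s * t + s * u
    *-distribˡ (x ⊗ y) t u = ~-refl
    *-distribˡ 0#      t u = ~-sym (+-identityˡ 0#)
    *-distribˡ (s + v) t u = ~-trans (+-cong (*-distribˡ s t u) (*-distribˡ v t u)) (swap _ _ _ _)
    *-distribˡ (- s)   t u = ~-trans (-‿cong (*-distribˡ s t u)) (neg-+ _ _)

    mulPure-mulPure : ∀ x y x′ y′ t →
      mulPure (x A.* x′) (y B.* y′) t ~ mulPure x y (mulPure x′ y′ t)
    mulPure-mulPure x y x′ y′ (u ⊗ v) = ⊗-cong (A.*-assoc x x′ u) (B.*-assoc y y′ v)
    mulPure-mulPure x y x′ y′ 0#      = ~-refl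
    mulPure-mulPure x y x′ y′ (s + t) =
      +-cong (mulPure-mulPure x y x′ y′ s) (mulPure-mulPure x y x′ y′ t)
    mulPure-mulPure x y x′ y′ (- s)   = -‿cong (mulPure-mulPure x y x′ y′ s)

    mulPure-assoc : ∀ x y s t → mulPure x y s * t ~ mulPure x y (s * t)
    mulPure-assoc x y (x′ ⊗ y′) t = mulPure-mulPure x y x′ y′ t
    mulPure-assoc x y 0#        t = ~-refl
    mulPure-assoc x y (s + u)   t = +-cong (mulPure-assoc x y s t) (mulPure-assoc x y u t)
    mulPure-assoc x y (- s)     t = -‿cong (mulPure-assoc x y s t)

    *-assoc : ∀ s t u → (s * t) * u ~ s * (t * u)
    *-assoc (x ⊗ y) t u = mulPure-assoc x y t u
    *-assoc 0#      t u = ~-refl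
    *-assoc (s + v) t u = +-cong (*-assoc s t u) (*-assoc v t u)
    *-assoc (- s)   t u = -‿cong (*-assoc s t u)

    *-identityˡ : ∀ t → 1# * t ~ t
    *-identityˡ (x ⊗ y) = ⊗-cong (A.*-identityˡ x) (B.*-identityˡ y)
    *-identityˡ 0#      = ~-refl
    *-identityˡ (s + t) = +-cong (*-identityˡ s) (*-identityˡ t)
    *-identityˡ (- s)   = -‿cong (*-identityˡ s)

    *-identityʳ : ∀ t → t * 1# ~ t
    *-identityʳ (x ⊗ y) = ⊗-cong (A.*-identityʳ x) (B.*-identityʳ y)
    *-identityʳ 0#      = ~-refl
    *-identityʳ (s + t) = +-cong (*-identityʳ s) (*-identityʳ t)
    *-identityʳ (- s)   = -‿cong (*-identityʳ s)

    mulPure-•ˡ : ∀ k x y t → mulPure (k A.• x) y t ~ k • mulPure x y t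
    mulPure-•ˡ k x y (u ⊗ v) = ⊗-cong (A.•-*-assocˡ k x u) B.refl
    mulPure-•ˡ k x y 0#      = ~-refl
    mulPure-•ˡ k x y (s + t) = +-cong (mulPure-•ˡ k x y s) (mulPure-•ˡ k x y t)
    mulPure-•ˡ k x y (- s)   = -‿cong (mulPure-•ˡ k x y s)

    •-*-assocˡ : ∀ k s t → (k • s) * t ~ k • (s * t)
    •-*-assocˡ k (x ⊗ y) t = mulPure-•ˡ k x y t
    •-*-assocˡ k 0#      t = ~-refl
    •-*-assocˡ k (s + u) t = +-cong (•-*-assocˡ k s t) (•-*-assocˡ k u t)
    •-*-assocˡ k (- s)   t = -‿cong (•-*-assocˡ k s t)

    mulPure-•ʳ : ∀ k x y t → mulPure x y (k • t) ~ k • mulPure x y t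
    mulPure-•ʳ k x y (u ⊗ v) = ⊗-cong (A.•-*-assocʳ k x u) B.refl
    mulPure-•ʳ k x y 0#      = ~-refl
    mulPure-•ʳ k x y (s + t) = +-cong (mulPure-•ʳ k x y s) (mulPure-•ʳ k x y t)
    mulPure-•ʳ k x y (- s)   = -‿cong (mulPure-•ʳ k x y s)

    •-*-assocʳ : ∀ k s t → s * (k • t) ~ k • (s * t)
    •-*-assocʳ k (x ⊗ y) t = mulPure-•ʳ k x y t
    •-*-assocʳ k 0#      t = ~-refl
    •-*-assocʳ k (s + u) t = +-cong (•-*-assocʳ k s t) (•-*-assocʳ k u t)
    •-*-assocʳ k (- s)   t = -‿cong (•-*-assocʳ k s t)

  algebra : Algebra R (a ⊔ b) (c ⊔ a ⊔ ℓa ⊔ b ⊔ ℓb)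
  algebra = record
    { ring = record
      { Carrier = Tensor ; _≈_ = _~_ ; _+_ = _+_ ; _*_ = _*_ ; -_ = -_ ; 0# = 0# ; 1# = 1#
      ; isRing = record
        { +-isAbelianGroup = G.isAbelianGroup
        ; *-cong     = λ {s} {s′} {t} {t′} p q → ~-trans (*-congʳ t p) (*-congˡ s′ q)
        ; *-assoc    = *-assoc
        ; *-identity = *-identityˡ , *-identityʳ
        ; distrib    = *-distribˡ , λ s t u → ~-refl
        }
      }
    ; _•_ = _•_
    ; isLeftModule = record
      { isLeftSemimodule = record
        { +ᴹ-isCommutativeMonoid = G.isCommutativeMonoid
        ; isPreleftSemimodule = record
          { *ₗ-cong      = λ {k} {l} {s} {t} e p → ~-trans (•-congʳ e s) (•-congˡ l p)
          ; *ₗ-zeroˡ     = •-zeroˡ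
          ; *ₗ-distribʳ  = •-distribʳ
          ; *ₗ-identityˡ = •-identityˡ
          ; *ₗ-assoc     = •-assoc
          ; *ₗ-zeroʳ     = λ k → ~-refl
          ; *ₗ-distribˡ  = λ k s t → ~-refl
          }
        }
      ; -ᴹ‿cong    = -‿cong
      ; -ᴹ‿inverse = G.inverse
      }
    ; •-*-assocˡ = •-*-assocˡ
    ; •-*-assocʳ = •-*-assocʳ
    }

module Matrices {c ℓ} (R : CommutativeRing c ℓ) where
  open CommutativeRing R hiding (zero)
  open SemiringSum semiring

  Matrix : ℕ → Set c
  Matrix m = Fin m → Fin m → Carrier

  infix  4 _≈ᴹ_
  infixl 6 _+ᴹ_
  infixl 7 _*ᴹ_
  infixr 7 _•ᴹ_

  _≈ᴹ_ : ∀ {m} → Matrix m → Matrix m → Set ℓ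
  S ≈ᴹ T = ∀ i j → S i j ≈ T i j

  _+ᴹ_ : ∀ {m} → Matrix m → Matrix m → Matrix m
  (S +ᴹ T) i j = S i j + T i j

  -ᴹ_ : ∀ {m} → Matrix m → Matrix m
  (-ᴹ S) i j = - S i j

  0ᴹ : ∀ {m} → Matrix m
  0ᴹ _ _ = 0#

  1ᴹ : ∀ {m} → Matrix m
  1ᴹ i j with i ≟ j
  ... | yes _ = 1#
  ... | no  _ = 0#

  _*ᴹ_ : ∀ {m} → Matrix m → Matrix m → Matrix m
  (S *ᴹ T) i j = sum λ k → S i k * T k j

  _•ᴹ_ : ∀ {m} → Carrier → Matrix m → Matrix m
  (r •ᴹ S) i j = r * S i j

  IsSymmetric : ∀ {m} → Matrix m → Set ℓ
  IsSymmetric S = ∀ i j → S i j ≈ S j i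

  private
    sum-zero : ∀ {n} (f : Vector Carrier n) → (∀ k → f k ≈ 0#) → sum f ≈ 0#
    sum-zero {n} f z = trans (sum-cong-≋ z) (sum-replicate-zero n)

    1ᴹ-suc : ∀ {m} (i j : Fin m) → 1ᴹ (suc i) (suc j) ≈ 1ᴹ i j
    1ᴹ-suc i j with i ≟ j
    ... | yes _ = refl
    ... | no  _ = refl

    sum-δˡ : ∀ {n} (i : Fin n) (f : Vector Carrier n) → sum (λ k → 1ᴹ i k * f k) ≈ f i
    sum-δˡ zero    f = trans
      (+-cong (*-identityˡ (f zero)) (sum-zero _ (λ k → zeroˡ (f (suc k))))) (+-identityʳ (f zero))
    sum-δˡ (suc i) f = trans
      (+-cong (zeroˡ (f zero))
        (trans (sum-cong-≋ (λ k → *-congʳ (1ᴹ-suc i k))) (sum-δˡ i (λ k → f (suc k)))))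
      (+-identityˡ (f (suc i)))

    sum-δʳ : ∀ {n} (i : Fin n) (f : Vector Carrier n) → sum (λ k → f k * 1ᴹ k i) ≈ f i
    sum-δʳ zero    f = trans
      (+-cong (*-identityʳ (f zero)) (sum-zero _ (λ k → zeroʳ (f (suc k))))) (+-identityʳ (f zero))
    sum-δʳ (suc i) f = trans
      (+-cong (zeroʳ (f zero))
        (trans (sum-cong-≋ (λ k → *-congˡ (1ᴹ-suc k i))) (sum-δʳ i (λ k → f (suc k)))))
      (+-identityˡ (f (suc i)))

    *ᴹ-assoc : ∀ {m} (S T U : Matrix m) → (S *ᴹ T) *ᴹ U ≈ᴹ S *ᴹ (T *ᴹ U)
    *ᴹ-assoc S T U i j = begin
      sum (λ l → sum (λ k → S i k * T k l) * U l j)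
        ≈⟨ sum-cong-≋ (λ l → *-distribʳ-sum (U l j) (λ k → S i k * T k l)) ⟩
      sum (λ l → sum (λ k → (S i k * T k l) * U l j))
        ≈⟨ ∑-comm (λ l k → (S i k * T k l) * U l j) ⟩
      sum (λ k → sum (λ l → (S i k * T k l) * U l j))
        ≈⟨ sum-cong-≋ (λ k → sum-cong-≋ (λ l → *-assoc (S i k) (T k l) (U l j))) ⟩
      sum (λ k → sum (λ l → S i k * (T k l * U l j)))
        ≈⟨ sum-cong-≋ (λ k → *-distribˡ-sum (S i k) (λ l → T k l * U l j)) ⟨
      sum (λ k → S i k * sum (λ l → T k l * U l j)) ∎
      where open SetoidReasoning (CommutativeRing.setoid R)

  algebra : ℕ → Algebra R c ℓ
  algebra m = record
    { ring = record
      { Carrier = Matrix m ; _≈_ = _≈ᴹ_ ; _+_ = _+ᴹ_ ; _*_ = _*ᴹ_ ; -_ = -ᴹ_ ; 0# = 0ᴹ ; 1# = 1ᴹ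
      ; isRing = record
        { +-isAbelianGroup = record
          { isGroup = record
            { isMonoid = +-isMonoid′
            ; inverse = (λ S i j → -‿inverseˡ (S i j)) , (λ S i j → -‿inverseʳ (S i j))
            ; ⁻¹-cong = λ p i j → -‿cong (p i j)
            }
          ; comm = λ S T i j → +-comm (S i j) (T i j)
          }
        ; *-cong     = λ p q i j → sum-cong-≋ λ k → *-cong (p i k) (q k j)
        ; *-assoc    = *ᴹ-assoc
        ; *-identity = (λ S i j → sum-δˡ i (λ k → S k j)) , (λ S i j → sum-δʳ j (S i))
        ; distrib    =
            (λ S T U i j → trans (sum-cong-≋ λ k → distribˡ (S i k) (T k j) (U k j))
                                 (∑-distrib-+ (λ k → S i k * T k j) (λ k → S i k * U k j)))
          , (λ S T U i j → trans (sum-cong-≋ λ k → distribʳ (S k j) (T i k) (U i k))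
                                 (∑-distrib-+ (λ k → T i k * S k j) (λ k → U i k * S k j)))
        }
      }
    ; _•_ = _•ᴹ_
    ; isLeftModule = record
      { isLeftSemimodule = record
        { +ᴹ-isCommutativeMonoid = record
          { isMonoid = +-isMonoid′ ; comm = λ S T i j → +-comm (S i j) (T i j) }
        ; isPreleftSemimodule = record
          { *ₗ-cong      = λ e p i j → *-cong e (p i j)
          ; *ₗ-zeroˡ     = λ S i j → zeroˡ (S i j)
          ; *ₗ-distribʳ  = λ S k l i j → distribʳ (S i j) k l
          ; *ₗ-identityˡ = λ S i j → *-identityˡ (S i j)
          ; *ₗ-assoc     = λ k l S i j → *-assoc k l (S i j)
          ; *ₗ-zeroʳ     = λ k i j → zeroʳ k
          ; *ₗ-distribˡ  = λ k S T i j → distribˡ k (S i j) (T i j)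
          }
        }
      ; -ᴹ‿cong    = λ p i j → -‿cong (p i j)
      ; -ᴹ‿inverse = (λ S i j → -‿inverseˡ (S i j)) , (λ S i j → -‿inverseʳ (S i j))
      }
    ; •-*-assocˡ = λ r S T i j → trans (sum-cong-≋ λ k → *-assoc r (S i k) (T k j))
        (sym (*-distribˡ-sum r (λ k → S i k * T k j)))
    ; •-*-assocʳ = λ r S T i j → trans (sum-cong-≋ λ k → x∙yz≈y∙xz (S i k) r (T k j))
        (sym (*-distribˡ-sum r (λ k → S i k * T k j)))
    }
    where
    open import Algebra.Structures (_≈ᴹ_ {m}) using (IsMonoid)
    open import Algebra.Properties.CommutativeSemigroup *-commutativeSemigroup using (x∙yz≈y∙xz)
    +-isMonoid′ : IsMonoid _+ᴹ_ 0ᴹ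
    +-isMonoid′ = record
      { isSemigroup = record
        { isMagma = record
          { isEquivalence = record
            { refl = λ i j → refl ; sym = λ p i j → sym (p i j) ; trans = λ p q i j → trans (p i j) (q i j) }
          ; ∙-cong = λ p q i j → +-cong (p i j) (q i j)
          }
        ; assoc = λ S T U i j → +-assoc (S i j) (T i j) (U i j)
        }
      ; identity = (λ S i j → +-identityˡ (S i j)) , (λ S i j → +-identityʳ (S i j))
      }

module SelfDuality {c ℓ₁ ℓ₂} (K : HeytingField c ℓ₁ ℓ₂) where
  open HeytingField K hiding (zero)

  commutativeRing : CommutativeRing c ℓ₁
  commutativeRing = HeytingCommutativeRing.commutativeRing heytingCommutativeRing

  open SemiringSum (CommutativeRing.semiring commutativeRing) using (sum)
  open Matrices commutativeRing public renaming (algebra to matrixAlgebra)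

  inverse : ∀ {x} → x # 0# → Carrier
  inverse x#0 = proj₁ (#⇒invertible x#0)

  -- ᵗw S w
  quadraticForm : ∀ {m} → Matrix m → Vector Carrier m → Carrier
  quadraticForm S w = sum λ a → sum λ b → w a * S a b * w b

  record QuadraticMapping (m n : ℕ) : Set (c ⊔ ℓ₁) where
    field
      Q           : Vector Carrier m → Vector Carrier n
      S           : Vector (Matrix m) n
      S-symmetric : ∀ i → IsSymmetric (S i)
      Q≈          : ∀ w i → Q w i ≈ quadraticForm (S i) w

    S[_] : Vector Carrier n → Matrix m
    S[ v ] a b = sum λ i → v i * S i a b

  module _ (p q : ℕ) where

    P : Vector Carrier (p ℕ.+ q) → Carrier
    P v = sum (λ i → v (i ↑ˡ q) * v (i ↑ˡ q)) - sum (λ j → v (p ↑ʳ j) * v (p ↑ʳ j))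

    Ω : Set (c ⊔ ℓ₂)
    Ω = Σ[ v ∈ Vector Carrier (p ℕ.+ q) ] P v # 0#

    -- φ = ½ grad log P, with the gradient written out.
    φ : Ω → Vector Carrier (p ℕ.+ q)
    φ (v , Pv#0) k = inverse Pv#0 * ((λ i → v (i ↑ˡ q)) ++ (λ j → - v (p ↑ʳ j))) k

    IsSelfDual : ∀ {m} → QuadraticMapping m (p ℕ.+ q) → Set (c ⊔ ℓ₁ ⊔ ℓ₂)
    IsSelfDual {m} 𝒬 = ∀ (ω : Ω) → S[ proj₁ ω ] *ᴹ S[ φ ω ] ≈ᴹ 1ᴹ {m}
      where open QuadraticMapping 𝒬

    private
      module Cₚ = Clifford commutativeRing p
      module Cq = Clifford commutativeRing q
      open TensorProduct commutativeRing Cₚ.algebra Cq.algebra using (_⊗_)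

    cliffordTensor : Algebra commutativeRing c (c ⊔ ℓ₁)
    cliffordTensor = TensorProduct.algebra commutativeRing Cₚ.algebra Cq.algebra

    e : Vector (Algebra.Carrier cliffordTensor) (p ℕ.+ q)
    e = (λ i → Cₚ.gen i ⊗ Cq.1#) ++ (λ j → Cₚ.1# ⊗ Cq.gen j)

    -- The identification of V with the span of the e i.
    ι : Vector Carrier (p ℕ.+ q) → Algebra.Carrier cliffordTensor
    ι v = sumᴬ λ i → v i • e i
      where open Algebra cliffordTensor using (_•_) renaming (sum to sumᴬ)

    module _ (m : ℕ) where

      record SelfDualMapping : Set (c ⊔ ℓ₁ ⊔ ℓ₂) where
        field
          quadraticMapping : QuadraticMapping m (p ℕ.+ q)
          isSelfDual       : IsSelfDual quadraticMapping
        open QuadraticMapping quadraticMapping public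

      record SymmetricRepresentation : Set (c ⊔ ℓ₁) where
        field
          homomorphism : AlgebraHomomorphism cliffordTensor (matrixAlgebra m)
        open AlgebraHomomorphism homomorphism public renaming (⟦_⟧ to ρ)
        field
          ρ[V]-symmetric : ∀ v → IsSymmetric (ρ (ι v))

      -- Equality is that of the maps W → V; S is determined by the map Q.
      selfDualMappings : Setoid (c ⊔ ℓ₁ ⊔ ℓ₂) (c ⊔ ℓ₁)
      selfDualMappings = record
        { Carrier = SelfDualMapping
        ; _≈_ = λ F G → ∀ w i → SelfDualMapping.Q F w i ≈ SelfDualMapping.Q G w i
        ; isEquivalence = record
          { refl  = λ w i → refl
          ; sym   = λ f w i → sym (f w i)
          ; trans = λ f g w i → trans (f w i) (g w i)
          }
        }

      symmetricRepresentations : Setoid (c ⊔ ℓ₁) (c ⊔ ℓ₁)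
      symmetricRepresentations = record
        { Carrier = SymmetricRepresentation
        ; _≈_ = λ F G → ∀ x → SymmetricRepresentation.ρ F x ≈ᴹ SymmetricRepresentation.ρ G x
        ; isEquivalence = record
          { refl  = λ x i j → refl
          ; sym   = λ f x i j → sym (f x i j)
          ; trans = λ f g x i j → trans (f x i j) (g x i j)
          }
        }

open SelfDuality Real.heytingField public

{-# OPTIONS --safe #-}
module Submission where

-- Write εₖ = ± 1 for the signs of P. Each entry of P(v) (S(v) S(φ(v)) − 1) is a
-- quadratic form in v, with coefficients εₗ (Sₖ Sₗ)ₐᵦ − εₖ δₖₗ δₐᵦ. It vanishes
-- identically exactly when Sₖ² = 1 and εₗ Sₖ Sₗ + εₖ Sₗ Sₖ = 0 for k ≠ l, and these
-- are the defining relations of C_p ⊗ C_q. Vanishing on Ω suffices, because the test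
-- vectors eₖ and eₖ + 2 eₗ lie in Ω and determine the symmetrized coefficients.

open import Defs using (Algebra; AlgebraHomomorphism; module Presentation; module Clifford;
  module TensorProduct; module Matrices; module SelfDuality; module Real)
open import Algebra.Apartness.Bundles using (HeytingField)
open import Algebra.Bundles using (CommutativeRing)
import Algebra.Morphism.Construct.Composition as Composition
import Algebra.Properties.CommutativeSemigroup as CommutativeSemigroupProperties
import Algebra.Properties.Ring as RingProperties
import Algebra.Properties.Semiring.Sum as SemiringSum
open import Data.Fin using (Fin; zero; suc; _≟_; _↑ˡ_; _↑ʳ_; splitAt)
open import Data.Fin.Properties using (splitAt⁻¹-↑ˡ; splitAt⁻¹-↑ʳ; ↑ˡ-injective; ↑ʳ-injective; suc-injective)
import Data.Integer as ℤ
open import Data.Nat as ℕ using (ℕ; zero; suc)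
open import Data.Product using (Σ-syntax; _×_; _,_; proj₁; proj₂)
import Data.Rational as ℚ
open import Data.Sum using (inj₁; inj₂)
open import Data.Vec.Functional using (Vector; _++_)
open import Data.Vec.Functional.Properties using (lookup-++ˡ; lookup-++ʳ)
open import Function.Base using (_∘_; case_of_)
open import Function.Bundles using (Bijection)
open import Relation.Binary.PropositionalEquality as ≡ using (_≡_; _≢_)
open import Level using (_⊔_)
import Relation.Binary.Reasoning.Setoid as SetoidReasoning
open import Relation.Nullary using (yes; no; contradiction)

-- The algebra is carried out over a Heyting field, where equality with zero cannot be decided and
-- no limit argument is available. Density of Ω therefore gives nothing; each test vector must come
-- with an explicit inverse of its value under `P`. The vector eₖ + eₗ fails, because it is
-- isotropic when the signs of k and l differ. With the factor 2, `P` takes the values ± 5 and ± 3.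
-- A quadratic form sees its coefficients only through the sums of the (k , l) and (l , k) entries,
-- so self-duality constrains Sₖ Sₗ and Sₗ Sₖ only jointly. Opposite signs turn this constraint into
-- commutation, which is what an ungraded tensor product imposes on its two factors. Bijectivity
-- rests on two uniqueness facts: a representation is fixed by its values on the eₖ, which generate,
-- and Q fixes each Sₖ, because Sₖ is symmetric and 2 is invertible.

-- Algebras: elements that commute, and homomorphisms.

module AlgebraProperties {c ℓ a ℓa} {R : CommutativeRing c ℓ} (A : Algebra R a ℓa) where
  private module R = CommutativeRing R
  open Algebra A
  open RingProperties ring public
  open SetoidReasoning setoid

  •-‿distribʳ : ∀ k x → k • (- x) ≈ - (k • x)
  •-‿distribʳ k x = begin
    k • (- x)          ≈⟨ *ₗ-congˡ (-1*x≈-x x) ⟨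
    k • (- 1# * x)     ≈⟨ •-*-assocʳ k (- 1#) x ⟨
    - 1# * (k • x)     ≈⟨ -1*x≈-x (k • x) ⟩
    - (k • x)          ∎

  -1•x≈-x : ∀ x → (R.- R.1#) • x ≈ - x
  -1•x≈-x x = +-inverseˡ-unique _ x (begin
    (R.- R.1#) • x + x           ≈⟨ +-congˡ (*ₗ-identityˡ x) ⟨
    (R.- R.1#) • x + R.1# • x    ≈⟨ *ₗ-distribʳ x (R.- R.1#) R.1# ⟨
    (R.- R.1# R.+ R.1#) • x      ≈⟨ *ₗ-congʳ (R.-‿inverseˡ R.1#) ⟩
    R.0# • x                     ≈⟨ *ₗ-zeroˡ x ⟩
    0#                           ∎)

  -- The `commute-` lemmas together say that the centralizer of `z` is a subalgebra. Commutation
  -- thus passes from generators to everything they generate.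
  Commute : Carrier → Carrier → Set ℓa
  Commute x y = x * y ≈ y * x

  commute-0ˡ : ∀ z → Commute 0# z
  commute-0ˡ z = trans (zeroˡ z) (sym (zeroʳ z))

  commute-1ˡ : ∀ z → Commute 1# z
  commute-1ˡ z = trans (*-identityˡ z) (sym (*-identityʳ z))

  commute-‿ˡ : ∀ {x z} → Commute x z → Commute (- x) z
  commute-‿ˡ {x} {z} p =
    trans (sym (-‿distribˡ-* x z)) (trans (-‿cong p) (-‿distribʳ-* z x))

  commute-+ˡ : ∀ {x y z} → Commute x z → Commute y z → Commute (x + y) z
  commute-+ˡ {x} {y} {z} p q =
    trans (distribʳ z x y) (trans (+-cong p q) (sym (distribˡ z x y)))

  commute-*ˡ : ∀ {x y z} → Commute x z → Commute y z → Commute (x * y) z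
  commute-*ˡ {x} {y} {z} p q = begin
    (x * y) * z  ≈⟨ *-assoc x y z ⟩
    x * (y * z)  ≈⟨ *-congˡ q ⟩
    x * (z * y)  ≈⟨ *-assoc x z y ⟨
    (x * z) * y  ≈⟨ *-congʳ p ⟩
    (z * x) * y  ≈⟨ *-assoc z x y ⟩
    z * (x * y)  ∎

  commute-•ˡ : ∀ k {x z} → Commute x z → Commute (k • x) z
  commute-•ˡ k {x} {z} p =
    trans (•-*-assocˡ k x z) (trans (*ₗ-congˡ p) (sym (•-*-assocʳ k z x)))

  interchange-* : ∀ {x y z w} → Commute y z → (x * z) * (y * w) ≈ (x * y) * (z * w)
  interchange-* {x} {y} {z} {w} p = begin
    (x * z) * (y * w)  ≈⟨ *-assoc x z (y * w) ⟩
    x * (z * (y * w))  ≈⟨ *-congˡ (*-assoc z y w) ⟨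
    x * ((z * y) * w)  ≈⟨ *-congˡ (*-congʳ p) ⟨
    x * ((y * z) * w)  ≈⟨ *-congˡ (*-assoc y z w) ⟩
    x * (y * (z * w))  ≈⟨ *-assoc x y (z * w) ⟨
    (x * y) * (z * w)  ∎

module _ {c ℓ a ℓa b ℓb} {R : CommutativeRing c ℓ} {A : Algebra R a ℓa} {B : Algebra R b ℓb} where
  private
    module A = Algebra A
    module B = Algebra B
    module BP = AlgebraProperties B

  -- Additivity between groups already forces zero and negatives to be preserved, so neither appears
  -- among the conditions.
  algebraHomomorphism : (f : A.Carrier → B.Carrier) →
    (∀ {x y} → x A.≈ y → f x B.≈ f y) →
    (∀ x y → f (x A.+ y) B.≈ f x B.+ f y) →
    (∀ x y → f (x A.* y) B.≈ f x B.* f y) →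
    f A.1# B.≈ B.1# →
    (∀ k x → f (k A.• x) B.≈ k B.• f x) →
    AlgebraHomomorphism A B
  algebraHomomorphism f f-cong +-homo *-homo 1#-homo •-homo = record
    { ⟦_⟧ = f
    ; isAlgebraHomomorphism = record
      { isRingHomomorphism = record
        { isSemiringHomomorphism = record
          { isNearSemiringHomomorphism = record
            { +-isMonoidHomomorphism = record
              { isMagmaHomomorphism = record
                { isRelHomomorphism = record { cong = f-cong }
                ; homo = +-homo
                }
              ; ε-homo = f0≈0
              }
            ; *-homo = *-homo
            }
          ; 1#-homo = 1#-homo
          }
        ; -‿homo = λ x → BP.+-inverseˡ-unique (f (A.- x)) (f x)
            (B.trans (B.sym (+-homo (A.- x) x)) (B.trans (f-cong (A.-‿inverseˡ x)) f0≈0))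
        }
      ; •-homo = •-homo
      }
    }
    where
    f0≈0 : f A.0# B.≈ B.0#
    f0≈0 = BP.x+x≈x⇒x≈0 (f A.0#)
      (B.trans (B.sym (+-homo A.0# A.0#)) (f-cong (A.+-identityˡ A.0#)))

  module _ (h : AlgebraHomomorphism A B) where
    open AlgebraHomomorphism h

    sum-homo : ∀ {n} (xs : Vector A.Carrier n) → ⟦ A.sum xs ⟧ B.≈ B.sum (⟦_⟧ ∘ xs)
    sum-homo {zero}  xs = 0#-homo
    sum-homo {suc n} xs = B.trans (+-homo (xs zero) (A.sum (xs ∘ suc)))
      (B.+-congˡ (sum-homo (xs ∘ suc)))

_∘ᴴ_ : ∀ {c ℓ a ℓa b ℓb d ℓd} {R : CommutativeRing c ℓ}
  {A : Algebra R a ℓa} {B : Algebra R b ℓb} {D : Algebra R d ℓd} →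
  AlgebraHomomorphism B D → AlgebraHomomorphism A B → AlgebraHomomorphism A D
_∘ᴴ_ {D = D} g f = record
  { ⟦_⟧ = G.⟦_⟧ ∘ F.⟦_⟧
  ; isAlgebraHomomorphism = record
    { isRingHomomorphism =
        Composition.isRingHomomorphism D.trans F.isRingHomomorphism G.isRingHomomorphism
    ; •-homo = λ k x → D.trans (G.⟦⟧-cong (F.•-homo k x)) (G.•-homo k F.⟦ x ⟧)
    }
  }
  where
  module F = AlgebraHomomorphism f
  module G = AlgebraHomomorphism g
  module D = Algebra D

-- Universal property of an algebra given by generators and relations.

module PresentationUniversal {c ℓ b ℓb x} {R : CommutativeRing c ℓ} (B : Algebra R b ℓb)
    (X : Set x) where
  private
    module B = Algebra B
    module BP = AlgebraProperties B
  open Presentation R X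

  extend : (X → B.Carrier) → Term → B.Carrier
  extend f (gen x) = f x
  extend f 0#      = B.0#
  extend f 1#      = B.1#
  extend f (- s)   = B.- extend f s
  extend f (s + t) = extend f s B.+ extend f t
  extend f (s * t) = extend f s B.* extend f t
  extend f (k • s) = k B.• extend f s

  -- The centralizer of `z` is a subalgebra and contains the images of the generators. The induction
  -- is on terms, so it does not involve the relators.
  extend-commute : ∀ f {z} → (∀ x → BP.Commute (f x) z) → ∀ t → BP.Commute (extend f t) z
  extend-commute f p (gen x) = p x
  extend-commute f p 0#      = BP.commute-0ˡ _
  extend-commute f p 1#      = BP.commute-1ˡ _
  extend-commute f p (- s)   = BP.commute-‿ˡ (extend-commute f p s)
  extend-commute f p (s + t) = BP.commute-+ˡ (extend-commute f p s) (extend-commute f p t)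
  extend-commute f p (s * t) = BP.commute-*ˡ (extend-commute f p s) (extend-commute f p t)
  extend-commute f p (k • s) = BP.commute-•ˡ k (extend-commute f p s)

  module _ {r} (Relator : Term → Term → Set r) where
    open Quotient Relator

    module _ (f : X → B.Carrier)
        (respects : ∀ {s t} → Relator s t → extend f s B.≈ extend f t) where

      -- Every clause of the congruence except `relator` is a law valid in any algebra, so
      -- respecting the relators is the whole condition.
      extend-cong : ∀ {s t} → s ~ t → extend f s B.≈ extend f t
      extend-cong (relator r)        = respects r
      extend-cong ~-refl             = B.refl
      extend-cong (~-sym p)          = B.sym (extend-cong p)
      extend-cong (~-trans p q)      = B.trans (extend-cong p) (extend-cong q)
      extend-cong (+-cong p q)       = B.+-cong (extend-cong p) (extend-cong q)
      extend-cong (*-cong p q)       = B.*-cong (extend-cong p) (extend-cong q)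
      extend-cong (-‿cong p)         = B.-‿cong (extend-cong p)
      extend-cong (•-cong e p)       = B.*ₗ-cong e (extend-cong p)
      extend-cong (+-assoc s t u)    = B.+-assoc _ _ _
      extend-cong (+-comm s t)       = B.+-comm _ _
      extend-cong (+-identityˡ s)    = B.+-identityˡ _
      extend-cong (-‿inverseˡ s)     = B.-‿inverseˡ _
      extend-cong (*-assoc s t u)    = B.*-assoc _ _ _
      extend-cong (*-identityˡ s)    = B.*-identityˡ _
      extend-cong (*-identityʳ s)    = B.*-identityʳ _
      extend-cong (distribˡ s t u)   = B.distribˡ _ _ _
      extend-cong (distribʳ s t u)   = B.distribʳ _ _ _
      extend-cong (•-identityˡ s)    = B.*ₗ-identityˡ _
      extend-cong (•-assoc k l s)    = B.*ₗ-assoc k l _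
      extend-cong (•-distribˡ k s t) = B.*ₗ-distribˡ k _ _
      extend-cong (•-distribʳ s k l) = B.*ₗ-distribʳ _ k l
      extend-cong (•-*-assocˡ k s t) = B.•-*-assocˡ k _ _
      extend-cong (•-*-assocʳ k s t) = B.•-*-assocʳ k _ _

      extension : AlgebraHomomorphism algebra B
      extension = algebraHomomorphism (extend f) extend-cong (λ _ _ → B.refl) (λ _ _ → B.refl)
        B.refl (λ _ _ → B.refl)

    extension-unique : (g h : AlgebraHomomorphism algebra B) →
      let module G = AlgebraHomomorphism g
          module H = AlgebraHomomorphism h
      in (∀ x → G.⟦ gen x ⟧ B.≈ H.⟦ gen x ⟧) → ∀ t → G.⟦ t ⟧ B.≈ H.⟦ t ⟧
    extension-unique g h agree = go
      where
      module G = AlgebraHomomorphism g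
      module H = AlgebraHomomorphism h
      go : ∀ t → G.⟦ t ⟧ B.≈ H.⟦ t ⟧
      go (gen x) = agree x
      go 0#      = B.trans G.0#-homo (B.sym H.0#-homo)
      go 1#      = B.trans G.1#-homo (B.sym H.1#-homo)
      go (- s)   = B.trans (G.-‿homo s) (B.trans (B.-‿cong (go s)) (B.sym (H.-‿homo s)))
      go (s + t) = B.trans (G.+-homo s t)
        (B.trans (B.+-cong (go s) (go t)) (B.sym (H.+-homo s t)))
      go (s * t) = B.trans (G.*-homo s t)
        (B.trans (B.*-cong (go s) (go t)) (B.sym (H.*-homo s t)))
      go (k • s) = B.trans (G.•-homo k s)
        (B.trans (B.*ₗ-congˡ (go s)) (B.sym (H.•-homo k s)))

-- Universal property of the ungraded tensor product.

module TensorUniversal {c ℓ a ℓa b ℓb d ℓd} {R : CommutativeRing c ℓ}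
    (A : Algebra R a ℓa) (B : Algebra R b ℓb) (D : Algebra R d ℓd) where
  private
    module A = Algebra A
    module B = Algebra B
    module D = Algebra D
    module DP = AlgebraProperties D
  open TensorProduct R A B

  includeˡ : AlgebraHomomorphism A algebra
  includeˡ = algebraHomomorphism (_⊗ B.1#) (λ p → ⊗-cong p B.refl)
    (λ x y → ⊗-distribʳ x y B.1#)
    (λ x y → ⊗-cong A.refl (B.sym (B.*-identityˡ B.1#)))
    ~-refl (λ _ _ → ~-refl)

  includeʳ : AlgebraHomomorphism B algebra
  includeʳ = algebraHomomorphism (A.1# ⊗_) (⊗-cong A.refl)
    (⊗-distribˡ A.1#)
    (λ x y → ⊗-cong (A.sym (A.*-identityˡ A.1#)) B.refl)
    ~-refl (λ k y → ~-sym (⊗-balanced k A.1# y))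

  -- Both products reduce to `x ⊗ y`; no sign arises, because the multiplication of pure tensors is
  -- ungraded.
  include-commute : ∀ x y → (x ⊗ B.1#) * (A.1# ⊗ y) ~ (A.1# ⊗ y) * (x ⊗ B.1#)
  include-commute x y = ⊗-cong
    (A.trans (A.*-identityʳ x) (A.sym (A.*-identityˡ x)))
    (B.trans (B.*-identityˡ y) (B.sym (B.*-identityʳ y)))

  ⊗-factor : ∀ x y → x ⊗ y ~ (x ⊗ B.1#) * (A.1# ⊗ y)
  ⊗-factor x y = ⊗-cong (A.sym (A.*-identityʳ x)) (B.sym (B.*-identityˡ y))

  module _ (f : AlgebraHomomorphism A D) (g : AlgebraHomomorphism B D) where
    private
      module F = AlgebraHomomorphism f
      module G = AlgebraHomomorphism g

    -- The linear map induced by the balanced biadditive map sending x and y to f(x) g(y). It is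
    -- well defined for any `f` and `g`; commuting images are required only for multiplicativity.
    pairing : Tensor → D.Carrier
    pairing (x ⊗ y) = F.⟦ x ⟧ D.* G.⟦ y ⟧
    pairing 0#      = D.0#
    pairing (s + t) = pairing s D.+ pairing t
    pairing (- s)   = D.- pairing s

    pairing-cong : ∀ {s t} → s ~ t → pairing s D.≈ pairing t
    pairing-cong ~-refl          = D.refl
    pairing-cong (~-sym p)       = D.sym (pairing-cong p)
    pairing-cong (~-trans p q)   = D.trans (pairing-cong p) (pairing-cong q)
    pairing-cong (+-cong p q)    = D.+-cong (pairing-cong p) (pairing-cong q)
    pairing-cong (-‿cong p)      = D.-‿cong (pairing-cong p)
    pairing-cong (+-assoc s t u) = D.+-assoc _ _ _
    pairing-cong (+-comm s t)    = D.+-comm _ _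
    pairing-cong (+-identityˡ s) = D.+-identityˡ _
    pairing-cong (-‿inverseˡ s)  = D.-‿inverseˡ _
    pairing-cong (⊗-cong p q)    = D.*-cong (F.⟦⟧-cong p) (G.⟦⟧-cong q)
    pairing-cong (⊗-distribˡ x y y′) =
      D.trans (D.*-congˡ (G.+-homo y y′)) (D.distribˡ _ _ _)
    pairing-cong (⊗-distribʳ x x′ y) =
      D.trans (D.*-congʳ (F.+-homo x x′)) (D.distribʳ _ _ _)
    pairing-cong (⊗-balanced k x y) = D.trans (D.*-congʳ (F.•-homo k x))
      (D.trans (D.•-*-assocˡ k _ _)
        (D.trans (D.sym (D.•-*-assocʳ k _ _)) (D.*-congˡ (D.sym (G.•-homo k y)))))

    pairing-• : ∀ k t → pairing (k • t) D.≈ k D.• pairing t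
    pairing-• k (x ⊗ y) = D.trans (D.*-congʳ (F.•-homo k x)) (D.•-*-assocˡ k _ _)
    pairing-• k 0#      = D.sym (D.*ₗ-zeroʳ k)
    pairing-• k (s + t) =
      D.trans (D.+-cong (pairing-• k s) (pairing-• k t)) (D.sym (D.*ₗ-distribˡ k _ _))
    pairing-• k (- s)   =
      D.trans (D.-‿cong (pairing-• k s)) (D.sym (DP.•-‿distribʳ k (pairing s)))

    module _ (commute : ∀ x y → DP.Commute F.⟦ x ⟧ G.⟦ y ⟧) where

      pairing-mulPure : ∀ x y t →
        pairing (mulPure x y t) D.≈ (F.⟦ x ⟧ D.* G.⟦ y ⟧) D.* pairing t
      pairing-mulPure x y (u ⊗ v) = D.trans (D.*-cong (F.*-homo x u) (G.*-homo y v))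
        (D.sym (DP.interchange-* (commute u y)))
      pairing-mulPure x y 0#      = D.sym (D.zeroʳ _)
      pairing-mulPure x y (s + t) =
        D.trans (D.+-cong (pairing-mulPure x y s) (pairing-mulPure x y t))
          (D.sym (D.distribˡ _ _ _))
      pairing-mulPure x y (- s)   =
        D.trans (D.-‿cong (pairing-mulPure x y s)) (DP.-‿distribʳ-* _ _)

      pairing-* : ∀ s t → pairing (s * t) D.≈ pairing s D.* pairing t
      pairing-* (x ⊗ y) t = pairing-mulPure x y t
      pairing-* 0#      t = D.sym (D.zeroˡ _)
      pairing-* (s + u) t = D.trans (D.+-cong (pairing-* s t) (pairing-* u t))
        (D.sym (D.distribʳ _ _ _))
      pairing-* (- s)   t = D.trans (D.-‿cong (pairing-* s t)) (DP.-‿distribˡ-* _ _)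

      tensorHomomorphism : AlgebraHomomorphism algebra D
      tensorHomomorphism = algebraHomomorphism pairing pairing-cong (λ _ _ → D.refl) pairing-*
        (D.trans (D.*-cong F.1#-homo G.1#-homo) (D.*-identityˡ D.1#)) pairing-•

  -- By `⊗-factor`, the images of the two inclusions generate the tensor product as a ring.
  tensor-unique : (g h : AlgebraHomomorphism algebra D) →
    let module G = AlgebraHomomorphism g
        module H = AlgebraHomomorphism h
    in (∀ x → G.⟦ x ⊗ B.1# ⟧ D.≈ H.⟦ x ⊗ B.1# ⟧) →
       (∀ y → G.⟦ A.1# ⊗ y ⟧ D.≈ H.⟦ A.1# ⊗ y ⟧) →
       ∀ t → G.⟦ t ⟧ D.≈ H.⟦ t ⟧
  tensor-unique g h agreeˡ agreeʳ = go
    where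
    module G = AlgebraHomomorphism g
    module H = AlgebraHomomorphism h
    go : ∀ t → G.⟦ t ⟧ D.≈ H.⟦ t ⟧
    go (x ⊗ y) = begin
      G.⟦ x ⊗ y ⟧                              ≈⟨ G.⟦⟧-cong (⊗-factor x y) ⟩
      G.⟦ (x ⊗ B.1#) * (A.1# ⊗ y) ⟧            ≈⟨ G.*-homo (x ⊗ B.1#) (A.1# ⊗ y) ⟩
      G.⟦ x ⊗ B.1# ⟧ D.* G.⟦ A.1# ⊗ y ⟧        ≈⟨ D.*-cong (agreeˡ x) (agreeʳ y) ⟩
      H.⟦ x ⊗ B.1# ⟧ D.* H.⟦ A.1# ⊗ y ⟧        ≈⟨ H.*-homo (x ⊗ B.1#) (A.1# ⊗ y) ⟨
      H.⟦ (x ⊗ B.1#) * (A.1# ⊗ y) ⟧            ≈⟨ H.⟦⟧-cong (⊗-factor x y) ⟨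
      H.⟦ x ⊗ y ⟧                              ∎
      where open SetoidReasoning D.setoid
    go 0#      = D.trans G.0#-homo (D.sym H.0#-homo)
    go (s + t) = D.trans (G.+-homo s t)
      (D.trans (D.+-cong (go s) (go t)) (D.sym (H.+-homo s t)))
    go (- s)   = D.trans (G.-‿homo s) (D.trans (D.-‿cong (go s)) (D.sym (H.-‿homo s)))

-- Bilinear and quadratic forms over a commutative ring.

module BilinearForms {c ℓ} (R : CommutativeRing c ℓ) where
  open CommutativeRing R hiding (zero)
  open SemiringSum semiring
  open Matrices R renaming (algebra to matrixAlgebra)
  open CommutativeSemigroupProperties *-commutativeSemigroup
    using (interchange; x∙yz≈y∙xz; xy∙z≈xz∙y; xy∙z≈zy∙x)
  open SetoidReasoning setoid

  -- This is the left identity law of the matrix algebra, applied to the square matrix all of whose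
  -- columns equal `f`.
  sum-δ : ∀ {n} i (f : Vector Carrier n) → sum (λ k → 1ᴹ i k * f k) ≈ f i
  sum-δ {n} i f = Algebra.*-identityˡ (matrixAlgebra n) (λ k _ → f k) i i

  1ᴹ-diagonal : ∀ {n} (i : Fin n) → 1ᴹ i i ≈ 1#
  1ᴹ-diagonal i with i ≟ i
  ... | yes _   = refl
  ... | no  i≢i = contradiction ≡.refl i≢i

  1ᴹ-offDiagonal : ∀ {n} {i j : Fin n} → i ≢ j → 1ᴹ i j ≈ 0#
  1ᴹ-offDiagonal {i = i} {j} i≢j with i ≟ j
  ... | yes i≡j = contradiction i≡j i≢j
  ... | no  _   = refl

  sum-++ : ∀ m {n} (f : Vector Carrier (m ℕ.+ n)) →
    sum f ≈ sum (λ i → f (i ↑ˡ n)) + sum (λ j → f (m ↑ʳ j))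
  sum-++ zero    f = sym (+-identityˡ (sum f))
  sum-++ (suc m) f = trans (+-congˡ (sum-++ m (f ∘ suc))) (sym (+-assoc _ _ _))

  sum-cong₂ : ∀ {m n} {f g : Fin m → Fin n → Carrier} → (∀ i j → f i j ≈ g i j) →
    (sum λ i → sum (f i)) ≈ (sum λ i → sum (g i))
  sum-cong₂ p = sum-cong-≋ λ i → sum-cong-≋ (p i)

  *-distribˡ-sum₂ : ∀ {m n} k (f : Fin m → Fin n → Carrier) →
    k * (sum λ i → sum (f i)) ≈ (sum λ i → sum λ j → k * f i j)
  *-distribˡ-sum₂ k f =
    trans (*-distribˡ-sum k (λ i → sum (f i))) (sum-cong-≋ λ i → *-distribˡ-sum k (f i))

  sum₂-distrib-+ : ∀ {m n} (f g : Fin m → Fin n → Carrier) →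
    (sum λ i → sum λ j → f i j + g i j) ≈ (sum λ i → sum (f i)) + (sum λ i → sum (g i))
  sum₂-distrib-+ f g =
    trans (sum-cong-≋ λ i → ∑-distrib-+ (f i) (g i)) (∑-distrib-+ (λ i → sum (f i)) _)

  *-sum-sum : ∀ {m n} (f : Vector Carrier m) (g : Vector Carrier n) →
    sum f * sum g ≈ (sum λ i → sum λ j → f i * g j)
  *-sum-sum f g =
    trans (*-distribʳ-sum (sum g) f) (sum-cong-≋ λ i → *-distribˡ-sum (f i) g)

  -- On the diagonal, `bilinearForm S w w` unfolds to `quadraticForm S w`, so the lemmas below apply
  -- to quadratic mappings directly.
  bilinearForm : ∀ {n} → Matrix n → Vector Carrier n → Vector Carrier n → Carrier
  bilinearForm S u w = sum λ a → sum λ b → u a * S a b * w b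

  bilinearForm-congᴹ : ∀ {n} {S T : Matrix n} u w → S ≈ᴹ T →
    bilinearForm S u w ≈ bilinearForm T u w
  bilinearForm-congᴹ u w p = sum-cong₂ λ a b → *-congʳ (*-congˡ (p a b))

  bilinearForm-linearᴹ : ∀ {n} (S T : Matrix n) k u w →
    bilinearForm (λ i j → S i j + k * T i j) u w ≈ bilinearForm S u w + k * bilinearForm T u w
  bilinearForm-linearᴹ {n} S T k u w = begin
    bilinearForm (λ i j → S i j + k * T i j) u w
      ≈⟨ sum-cong₂ (λ i j → begin
           u i * (S i j + k * T i j) * w j
             ≈⟨ *-congʳ (distribˡ (u i) (S i j) (k * T i j)) ⟩
           (u i * S i j + u i * (k * T i j)) * w j
             ≈⟨ distribʳ (w j) _ _ ⟩
           u i * S i j * w j + u i * (k * T i j) * w j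
             ≈⟨ +-congˡ (trans (*-congʳ (x∙yz≈y∙xz (u i) k (T i j))) (*-assoc k _ (w j))) ⟩
           u i * S i j * w j + k * (u i * T i j * w j) ∎) ⟩
    (sum λ i → sum λ j → u i * S i j * w j + k * (u i * T i j * w j))
      ≈⟨ sum₂-distrib-+ {n} {n} _ _ ⟩
    bilinearForm S u w + (sum λ i → sum λ j → k * (u i * T i j * w j))
      ≈⟨ +-congˡ (*-distribˡ-sum₂ {n} {n} k _) ⟨
    bilinearForm S u w + k * bilinearForm T u w ∎

  bilinearForm-zeroᴹ : ∀ {n} {S : Matrix n} u w → S ≈ᴹ 0ᴹ → bilinearForm S u w ≈ 0#
  bilinearForm-zeroᴹ {n} {S} u w p = begin
    bilinearForm S u w
      -- Each zero is written as `0# * 0#`, so that one factor can be pulled out of the double sum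
      -- and annihilate it.
      ≈⟨ sum-cong₂ (λ i j → trans (*-congʳ (trans (*-congˡ (p i j)) (zeroʳ (u i))))
           (trans (zeroˡ (w j)) (sym (zeroˡ 0#)))) ⟩
    (sum {n} λ i → sum {n} λ j → 0# * 0#)
      ≈⟨ *-distribˡ-sum₂ {n} {n} 0# (λ _ _ → 0#) ⟨
    0# * (sum {n} λ i → sum {n} λ j → 0#)
      ≈⟨ zeroˡ _ ⟩
    0# ∎

  bilinearForm-congʳ : ∀ {n} (S : Matrix n) u {w w′} → (∀ b → w b ≈ w′ b) →
    bilinearForm S u w ≈ bilinearForm S u w′
  bilinearForm-congʳ {n} S u p = sum-cong₂ {n} {n} λ a b → *-congˡ (p b)

  bilinearForm-+ˡ : ∀ {n} (S : Matrix n) u u′ w →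
    bilinearForm S (λ a → u a + u′ a) w ≈ bilinearForm S u w + bilinearForm S u′ w
  bilinearForm-+ˡ {n} S u u′ w = trans
    (sum-cong₂ λ a b → trans (*-congʳ (distribʳ (S a b) (u a) (u′ a))) (distribʳ (w b) _ _))
    (sum₂-distrib-+ {n} {n} _ _)

  bilinearForm-+ʳ : ∀ {n} (S : Matrix n) u w w′ →
    bilinearForm S u (λ b → w b + w′ b) ≈ bilinearForm S u w + bilinearForm S u w′
  bilinearForm-+ʳ {n} S u w w′ = trans
    (sum-cong₂ λ a b → distribˡ (u a * S a b) (w b) (w′ b))
    (sum₂-distrib-+ {n} {n} _ _)

  bilinearForm-*ˡ : ∀ {n} (S : Matrix n) k u w →
    bilinearForm S (λ a → k * u a) w ≈ k * bilinearForm S u w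
  bilinearForm-*ˡ {n} S k u w = trans
    (sum-cong₂ λ a b → trans (*-congʳ (*-assoc k (u a) (S a b))) (*-assoc k _ (w b)))
    (sym (*-distribˡ-sum₂ {n} {n} k _))

  bilinearForm-*ʳ : ∀ {n} (S : Matrix n) k u w →
    bilinearForm S u (λ b → k * w b) ≈ k * bilinearForm S u w
  bilinearForm-*ʳ {n} S k u w = trans
    (sum-cong₂ λ a b → x∙yz≈y∙xz (u a * S a b) k (w b))
    (sym (*-distribˡ-sum₂ {n} {n} k _))

  bilinearForm-δ : ∀ {n} (S : Matrix n) i j → bilinearForm S (1ᴹ i) (1ᴹ j) ≈ S i j
  bilinearForm-δ S i j = begin
    bilinearForm S (1ᴹ i) (1ᴹ j)
      ≈⟨ sum-cong-≋ (λ a → sum-cong-≋ λ b → *-comm (1ᴹ i a * S a b) (1ᴹ j b)) ⟩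
    (sum λ a → sum λ b → 1ᴹ j b * (1ᴹ i a * S a b))
      ≈⟨ sum-cong-≋ (λ a → sum-δ j (λ b → 1ᴹ i a * S a b)) ⟩
    (sum λ a → 1ᴹ i a * S a j)
      ≈⟨ sum-δ i (λ a → S a j) ⟩
    S i j ∎

  bilinearForm-polarize : ∀ {n} (S : Matrix n) u w →
    bilinearForm S (λ a → u a + w a) (λ a → u a + w a) ≈
    (bilinearForm S u u + bilinearForm S w w) + (bilinearForm S u w + bilinearForm S w u)
  bilinearForm-polarize S u w = begin
    bilinearForm S u+w u+w
      ≈⟨ bilinearForm-+ˡ S u w u+w ⟩
    bilinearForm S u u+w + bilinearForm S w u+w
      ≈⟨ +-cong (bilinearForm-+ʳ S u u w) (trans (bilinearForm-+ʳ S w u w) (+-comm _ _)) ⟩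
    (bilinearForm S u u + bilinearForm S u w) + (bilinearForm S w w + bilinearForm S w u)
      ≈⟨ interchange-+ _ _ _ _ ⟩
    (bilinearForm S u u + bilinearForm S w w) + (bilinearForm S u w + bilinearForm S w u) ∎
    where
    u+w = λ a → u a + w a
    open CommutativeSemigroupProperties +-commutativeSemigroup
      renaming (interchange to interchange-+)

  -- Once the two diagonal entries are known, the value at this single vector isolates the
  -- symmetrized coefficient, scaled by `t`.
  bilinearForm-polarize-δ : ∀ {n} (S : Matrix n) t i j →
    let v = λ a → 1ᴹ i a + t * 1ᴹ j a in
    bilinearForm S v v ≈ (S i i + t * (t * S j j)) + t * (S i j + S j i)
  bilinearForm-polarize-δ S t i j = trans (bilinearForm-polarize S (1ᴹ i) tδ) (+-cong
    (+-cong (bilinearForm-δ S i i)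
      (trans (bilinearForm-*ˡ S t (1ᴹ j) tδ) (*-congˡ (scaled j))))
    (trans (+-cong (scaled i)
        (trans (bilinearForm-*ˡ S t (1ᴹ j) (1ᴹ i)) (*-congˡ (bilinearForm-δ S j i))))
      (sym (distribˡ t (S i j) (S j i)))))
    where
    tδ = λ a → t * 1ᴹ j a
    scaled : ∀ k → bilinearForm S (1ᴹ k) tδ ≈ t * S k j
    scaled k = trans (bilinearForm-*ʳ S t (1ᴹ k) (1ᴹ j)) (*-congˡ (bilinearForm-δ S k j))

  -- All that a quadratic form reveals about its coefficient matrix. Leaving out the factor 1/2
  -- avoids division at this stage.
  symmetrized : ∀ {n} → Matrix n → Matrix n
  symmetrized S i j = S i j + S j i

  -- Transposing the matrix does not change its quadratic form: it amounts to exchanging the two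
  -- summation indices.
  bilinearForm-symmetrized : ∀ {n} (S : Matrix n) w →
    bilinearForm (symmetrized S) w w ≈ bilinearForm S w w + bilinearForm S w w
  bilinearForm-symmetrized {n} S w = begin
    bilinearForm (symmetrized S) w w
      ≈⟨ sum-cong₂ (λ a b → trans (*-congʳ (distribˡ (w a) (S a b) (S b a)))
           (distribʳ (w b) (w a * S a b) (w a * S b a))) ⟩
    (sum λ a → sum λ b → w a * S a b * w b + w a * S b a * w b)
      ≈⟨ sum₂-distrib-+ {n} {n} _ _ ⟩
    bilinearForm S w w + (sum λ a → sum λ b → w a * S b a * w b)
      ≈⟨ +-congˡ (sum-cong₂ λ a b → xy∙z≈zy∙x (w a) (S b a) (w b)) ⟩
    bilinearForm S w w + (sum λ a → sum λ b → w b * S b a * w a)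
      ≈⟨ +-congˡ (∑-comm λ a b → w b * S b a * w a) ⟩
    bilinearForm S w w + bilinearForm S w w ∎

  -- Reordering the triple sum turns an identity between products of linear combinations of matrices
  -- into one scalar form for each entry (a , b).
  bilinearForm-*ᴹ : ∀ {m n} (S : Vector (Matrix m) n) (u w : Vector Carrier n) a b →
    ((λ a c → sum λ i → u i * S i a c) *ᴹ (λ c b → sum λ j → w j * S j c b)) a b ≈
    bilinearForm (λ i j → (S i *ᴹ S j) a b) u w
  bilinearForm-*ᴹ S u w a b = begin
    (sum λ c → (sum λ i → u i * S i a c) * (sum λ j → w j * S j c b))
      ≈⟨ sum-cong-≋ (λ c → *-sum-sum (λ i → u i * S i a c) (λ j → w j * S j c b)) ⟩
    (sum λ c → sum λ i → sum λ j → (u i * S i a c) * (w j * S j c b))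
      ≈⟨ ∑-comm (λ c i → sum λ j → (u i * S i a c) * (w j * S j c b)) ⟩
    (sum λ i → sum λ c → sum λ j → (u i * S i a c) * (w j * S j c b))
      ≈⟨ sum-cong-≋ (λ i → ∑-comm λ c j → (u i * S i a c) * (w j * S j c b)) ⟩
    (sum λ i → sum λ j → sum λ c → (u i * S i a c) * (w j * S j c b))
      ≈⟨ sum-cong₂ (λ i j → trans
           (sum-cong-≋ λ c → interchange (u i) (S i a c) (w j) (S j c b))
           (sym (*-distribˡ-sum (u i * w j) λ c → S i a c * S j c b))) ⟩
    (sum λ i → sum λ j → u i * w j * (S i *ᴹ S j) a b)
      ≈⟨ sum-cong₂ (λ i j → xy∙z≈xz∙y (u i) (w j) ((S i *ᴹ S j) a b)) ⟩
    bilinearForm (λ i j → (S i *ᴹ S j) a b) u w ∎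

  matrix-sum : ∀ {m n} (S : Vector (Matrix m) n) a b →
    Algebra.sum (matrixAlgebra m) S a b ≈ sum λ i → S i a b
  matrix-sum {n = zero}  S a b = refl
  matrix-sum {n = suc n} S a b = +-congˡ (matrix-sum (S ∘ suc) a b)

-- Homomorphisms out of C_p ⊗ C_q as families satisfying the Clifford relations.

++-elim : ∀ {ℓ} m {n} (Q : Fin (m ℕ.+ n) → Set ℓ) →
  (∀ i → Q (i ↑ˡ n)) → (∀ j → Q (m ↑ʳ j)) → ∀ k → Q k
++-elim m Q left right k with splitAt m k in eq
... | inj₁ i = ≡.subst Q (splitAt⁻¹-↑ˡ eq) (left i)
... | inj₂ j = ≡.subst Q (splitAt⁻¹-↑ʳ {m} eq) (right j)

↑ˡ≢↑ʳ : ∀ {m n} (i : Fin m) (j : Fin n) → i ↑ˡ n ≢ m ↑ʳ j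
↑ˡ≢↑ʳ (suc i) j eq = ↑ˡ≢↑ʳ i j (suc-injective eq)

module CliffordFamilies {c ℓ₁ ℓ₂ d ℓd} (K : HeytingField c ℓ₁ ℓ₂) (p q : ℕ)
    (D : Algebra (SelfDuality.commutativeRing K) d ℓd) where
  open SelfDuality K using (commutativeRing; cliffordTensor; e)
  private
    module K  = CommutativeRing commutativeRing
    module Cₚ = Clifford commutativeRing p
    module Cq = Clifford commutativeRing q
  open Algebra D
  open AlgebraProperties D
  open TensorProduct commutativeRing Cₚ.algebra Cq.algebra using (_⊗_)
  open TensorUniversal Cₚ.algebra Cq.algebra D

  sign : Vector K.Carrier (p ℕ.+ q)
  sign = _++_ {m = p} (λ _ → K.1#) (λ _ → K.- K.1#)

  sign-↑ˡ : ∀ i → sign (i ↑ˡ q) ≡ K.1#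
  sign-↑ˡ = lookup-++ˡ {n = q} (λ _ → K.1#) (λ _ → K.- K.1#)

  sign-↑ʳ : ∀ j → sign (p ↑ʳ j) ≡ K.- K.1#
  sign-↑ʳ = lookup-++ʳ {m = p} {n = q} (λ _ → K.1#) (λ _ → K.- K.1#)

  -- The relation for k ≢ l says that S k and S l anticommute when the two signs
  -- agree and commute when they differ.
  record IsCliffordFamily (S : Vector Carrier (p ℕ.+ q)) : Set (d ⊔ ℓd) where
    field
      square  : ∀ k → S k * S k ≈ 1#
      twisted : ∀ {k l} → k ≢ l → sign l • (S k * S l) + sign k • (S l * S k) ≈ 0#

  private
    negate : ∀ x → (K.- K.1#) • x ≈ - x
    negate = -1•x≈-x

    -- These six implications translate `twisted` for the sign patterns (+ , +), (- , -) and mixed.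
    -- One mixed pattern is enough, because exchanging k and l only swaps the two summands.
    x+y≈0⇒x≈-y : ∀ {x y} → K.1# • x + K.1# • y ≈ 0# → x ≈ - y
    x+y≈0⇒x≈-y {x} {y} eq = +-inverseˡ-unique x y
      (trans (sym (+-cong (*ₗ-identityˡ x) (*ₗ-identityˡ y))) eq)

    x≈-y⇒x+y≈0 : ∀ {x y} → x ≈ - y → K.1# • x + K.1# • y ≈ 0#
    x≈-y⇒x+y≈0 {x} {y} eq = trans (+-cong (trans (*ₗ-identityˡ x) eq) (*ₗ-identityˡ y)) (-‿inverseˡ y)

    -x-y≈0⇒x≈-y : ∀ {x y} → (K.- K.1#) • x + (K.- K.1#) • y ≈ 0# → x ≈ - y
    -x-y≈0⇒x≈-y {x} {y} eq = -‿injective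
      (+-inverseˡ-unique (- x) (- y) (trans (sym (+-cong (negate x) (negate y))) eq))

    x≈-y⇒-x-y≈0 : ∀ {x y} → x ≈ - y → (K.- K.1#) • x + (K.- K.1#) • y ≈ 0#
    x≈-y⇒-x-y≈0 {x} {y} eq = trans (+-cong (negate x) (trans (negate y) (sym eq))) (-‿inverseˡ x)

    -x+y≈0⇒x≈y : ∀ {x y} → (K.- K.1#) • x + K.1# • y ≈ 0# → x ≈ y
    -x+y≈0⇒x≈y {x} {y} eq = -‿injective
      (+-inverseˡ-unique (- x) y (trans (sym (+-cong (negate x) (*ₗ-identityˡ y))) eq))

    x≈y⇒-x+y≈0 : ∀ {x y} → x ≈ y → (K.- K.1#) • x + K.1# • y ≈ 0#
    x≈y⇒-x+y≈0 {x} {y} eq = trans (+-cong (negate x) (trans (*ₗ-identityˡ y) (sym eq))) (-‿inverseˡ x)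

  e-↑ˡ : ∀ i → e p q (i ↑ˡ q) ≡ Cₚ.gen i ⊗ Cq.1#
  e-↑ˡ = lookup-++ˡ (λ i → Cₚ.gen i ⊗ Cq.1#) (λ j → Cₚ.1# ⊗ Cq.gen j)

  e-↑ʳ : ∀ j → e p q (p ↑ʳ j) ≡ Cₚ.1# ⊗ Cq.gen j
  e-↑ʳ = lookup-++ʳ {m = p} (λ i → Cₚ.gen i ⊗ Cq.1#) (λ j → Cₚ.1# ⊗ Cq.gen j)

  clifford-square : ∀ {r} (f : AlgebraHomomorphism (Clifford.algebra commutativeRing r) D) →
    let open AlgebraHomomorphism f in
    ∀ i → ⟦ Clifford.gen i ⟧ * ⟦ Clifford.gen i ⟧ ≈ 1#
  clifford-square f i = trans (sym (*-homo _ _))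
    (trans (⟦⟧-cong (Presentation.Quotient.relator (Clifford.square i))) 1#-homo)
    where open AlgebraHomomorphism f

  clifford-anticommute : ∀ {r} (f : AlgebraHomomorphism (Clifford.algebra commutativeRing r) D) →
    let open AlgebraHomomorphism f in
    ∀ {i j} → i ≢ j →
    ⟦ Clifford.gen i ⟧ * ⟦ Clifford.gen j ⟧ ≈ - (⟦ Clifford.gen j ⟧ * ⟦ Clifford.gen i ⟧)
  clifford-anticommute f i≢j = trans (sym (*-homo _ _))
    (trans (⟦⟧-cong (Presentation.Quotient.relator (Clifford.anticommute i≢j)))
      (trans (-‿homo _) (-‿cong (*-homo _ _))))
    where open AlgebraHomomorphism f

  module _ (h : AlgebraHomomorphism (cliffordTensor p q) D) where
    open AlgebraHomomorphism h
    private
      hˡ = h ∘ᴴ includeˡ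
      hʳ = h ∘ᴴ includeʳ

      cross : ∀ i j → ⟦ Cₚ.gen i ⊗ Cq.1# ⟧ * ⟦ Cₚ.1# ⊗ Cq.gen j ⟧ ≈
                      ⟦ Cₚ.1# ⊗ Cq.gen j ⟧ * ⟦ Cₚ.gen i ⊗ Cq.1# ⟧
      cross i j = trans (sym (*-homo _ _))
        (trans (⟦⟧-cong (include-commute (Cₚ.gen i) (Cq.gen j))) (*-homo _ _))

    homomorphism⇒family : IsCliffordFamily (λ k → ⟦ e p q k ⟧)
    homomorphism⇒family = record
      { square  = ++-elim p _ squareˡ squareʳ
      ; twisted = λ {k} {l} → ++-elim p (λ k → ∀ l → k ≢ l → Twisted k l)
          (λ i → ++-elim p (λ l → i ↑ˡ q ≢ l → Twisted (i ↑ˡ q) l) (twistedˡˡ i) (λ j _ → twistedˡʳ i j))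
          (λ j → ++-elim p (λ l → p ↑ʳ j ≢ l → Twisted (p ↑ʳ j) l)
            (λ i _ → trans (+-comm _ _) (twistedˡʳ i j)) (twistedʳʳ j))
          k l
      }
      where
      Twisted : Fin (p ℕ.+ q) → Fin (p ℕ.+ q) → Set ℓd
      Twisted k l = sign l • (⟦ e p q k ⟧ * ⟦ e p q l ⟧) + sign k • (⟦ e p q l ⟧ * ⟦ e p q k ⟧) ≈ 0#

      squareˡ : ∀ i → ⟦ e p q (i ↑ˡ q) ⟧ * ⟦ e p q (i ↑ˡ q) ⟧ ≈ 1#
      squareˡ i rewrite e-↑ˡ i = clifford-square hˡ i

      squareʳ : ∀ j → ⟦ e p q (p ↑ʳ j) ⟧ * ⟦ e p q (p ↑ʳ j) ⟧ ≈ 1#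
      squareʳ j rewrite e-↑ʳ j = clifford-square hʳ j

      twistedˡˡ : ∀ i j → i ↑ˡ q ≢ j ↑ˡ q → Twisted (i ↑ˡ q) (j ↑ˡ q)
      twistedˡˡ i j i≢j rewrite sign-↑ˡ i | sign-↑ˡ j | e-↑ˡ i | e-↑ˡ j =
        x≈-y⇒x+y≈0 (clifford-anticommute hˡ (i≢j ∘ ≡.cong (_↑ˡ q)))

      twistedʳʳ : ∀ i j → p ↑ʳ i ≢ p ↑ʳ j → Twisted (p ↑ʳ i) (p ↑ʳ j)
      twistedʳʳ i j i≢j rewrite sign-↑ʳ i | sign-↑ʳ j | e-↑ʳ i | e-↑ʳ j =
        x≈-y⇒-x-y≈0 (clifford-anticommute hʳ (i≢j ∘ ≡.cong (p ↑ʳ_)))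

      twistedˡʳ : ∀ i j → Twisted (i ↑ˡ q) (p ↑ʳ j)
      twistedˡʳ i j rewrite sign-↑ˡ i | sign-↑ʳ j | e-↑ˡ i | e-↑ʳ j =
        x≈y⇒-x+y≈0 (cross i j)

  module _ {S : Vector Carrier (p ℕ.+ q)} (isFamily : IsCliffordFamily S) where
    open IsCliffordFamily isFamily
    private
      module Pₚ = PresentationUniversal D (Fin p)
      module Pq = PresentationUniversal D (Fin q)

      Sˡ : Vector Carrier p
      Sˡ i = S (i ↑ˡ q)

      Sʳ : Vector Carrier q
      Sʳ j = S (p ↑ʳ j)

      respectsˡ : ∀ {s t} → Cₚ.Relator s t → Pₚ.extend Sˡ s ≈ Pₚ.extend Sˡ t
      respectsˡ (Clifford.square i) = square (i ↑ˡ q)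
      respectsˡ (Clifford.anticommute {i} {j} i≢j) = x+y≈0⇒x≈-y
        (≡.subst₂ (λ α β → α • (Sˡ i * Sˡ j) + β • (Sˡ j * Sˡ i) ≈ 0#) (sign-↑ˡ j) (sign-↑ˡ i)
          (twisted (i≢j ∘ ↑ˡ-injective q i j)))

      respectsʳ : ∀ {s t} → Cq.Relator s t → Pq.extend Sʳ s ≈ Pq.extend Sʳ t
      respectsʳ (Clifford.square j) = square (p ↑ʳ j)
      respectsʳ (Clifford.anticommute {i} {j} i≢j) = -x-y≈0⇒x≈-y
        (≡.subst₂ (λ α β → α • (Sʳ i * Sʳ j) + β • (Sʳ j * Sʳ i) ≈ 0#) (sign-↑ʳ j) (sign-↑ʳ i)
          (twisted (i≢j ∘ ↑ʳ-injective p i j)))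

      cross : ∀ i j → Commute (Sˡ i) (Sʳ j)
      cross i j = -x+y≈0⇒x≈y
        (≡.subst₂ (λ α β → α • (Sˡ i * Sʳ j) + β • (Sʳ j * Sˡ i) ≈ 0#) (sign-↑ʳ j) (sign-↑ˡ i)
          (twisted (↑ˡ≢↑ʳ i j)))

    family⇒homomorphism : AlgebraHomomorphism (cliffordTensor p q) D
    family⇒homomorphism = tensorHomomorphism
      (Pₚ.extension Cₚ.Relator Sˡ respectsˡ) (Pq.extension Cq.Relator Sʳ respectsʳ)
      -- Commutation of generators is extended in two passes: for each fixed `Sˡ i` over all of C_q,
      -- then for the fixed image of `y` over all of C_p.
      λ x y → Pₚ.extend-commute Sˡ
        (λ i → sym (Pq.extend-commute Sʳ (λ j → sym (cross i j)) y)) x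

    family⇒homomorphism-e : ∀ k → AlgebraHomomorphism.⟦_⟧ family⇒homomorphism (e p q k) ≈ S k
    family⇒homomorphism-e = ++-elim p _
      (λ i → trans (⟦⟧-cong (Tensor.reflexive (e-↑ˡ i))) (*-identityʳ (Sˡ i)))
      (λ j → trans (⟦⟧-cong (Tensor.reflexive (e-↑ʳ j))) (*-identityˡ (Sʳ j)))
      where
      open AlgebraHomomorphism family⇒homomorphism
      module Tensor = Algebra (cliffordTensor p q)

  -- The two included factors generate the tensor product, and each factor is generated by its own
  -- part of the family `e`.
  homomorphism-unique : (g h : AlgebraHomomorphism (cliffordTensor p q) D) →
    let module G = AlgebraHomomorphism g
        module H = AlgebraHomomorphism h
    in (∀ k → G.⟦ e p q k ⟧ ≈ H.⟦ e p q k ⟧) → ∀ t → G.⟦ t ⟧ ≈ H.⟦ t ⟧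
  homomorphism-unique g h agree = tensor-unique g h
    (PresentationUniversal.extension-unique D (Fin p) Cₚ.Relator (g ∘ᴴ includeˡ) (h ∘ᴴ includeˡ)
      λ i → ≡.subst (λ x → G.⟦ x ⟧ ≈ H.⟦ x ⟧) (e-↑ˡ i) (agree (i ↑ˡ q)))
    (PresentationUniversal.extension-unique D (Fin q) Cq.Relator (g ∘ᴴ includeʳ) (h ∘ᴴ includeʳ)
      λ j → ≡.subst (λ x → G.⟦ x ⟧ ≈ H.⟦ x ⟧) (e-↑ʳ j) (agree (p ↑ʳ j)))
    where
    module G = AlgebraHomomorphism g
    module H = AlgebraHomomorphism h

-- Units and apartness from zero in a Heyting field.

module HeytingFieldProperties {c ℓ₁ ℓ₂} (K : HeytingField c ℓ₁ ℓ₂) where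
  open HeytingField K using (_#_; #⇒invertible; invertible⇒#)
  open SelfDuality K using (commutativeRing; inverse)
  open CommutativeRing commutativeRing
  open RingProperties ring
  open SetoidReasoning setoid

  private
    -- The field axioms relate `x # y` to invertibility of the difference `x - y`; for `y` zero that
    -- difference still has to be simplified.
    x-0≈x : ∀ x → x - 0# ≈ x
    x-0≈x x = trans (+-congˡ -0#≈0#) (+-identityʳ x)

  inverseʳ : ∀ {x} (x#0 : x # 0#) → x * inverse x#0 ≈ 1#
  inverseʳ {x} x#0 =
    trans (*-congʳ (sym (x-0≈x x))) (proj₂ (proj₂ (#⇒invertible x#0)))

  -- The source of every apartness statement below: an inverse is exhibited, and membership in Ω
  -- follows.
  unit⇒#0 : ∀ {x y} → x * y ≈ 1# → x # 0#
  unit⇒#0 {x} {y} xy≈1 = invertible⇒#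
    (y , trans (*-comm y _) [x-0]y≈1 , [x-0]y≈1)
    where
    [x-0]y≈1 : (x - 0#) * y ≈ 1#
    [x-0]y≈1 = trans (*-congʳ (x-0≈x x)) xy≈1

  #0-resp-≈ : ∀ {x y} → x ≈ y → x # 0# → y # 0#
  #0-resp-≈ x≈y x#0 = unit⇒#0 (trans (*-congʳ (sym x≈y)) (inverseʳ x#0))

  #0-‿ : ∀ {x} → x # 0# → - x # 0#
  #0-‿ {x} x#0 = unit⇒#0 (trans (-x*-y≈x*y x (inverse x#0)) (inverseʳ x#0))
    where
    -x*-y≈x*y : ∀ x y → - x * - y ≈ x * y
    -x*-y≈x*y x y = trans (sym (-‿distribˡ-* x (- y)))
      (trans (-‿cong (sym (-‿distribʳ-* x y))) (-‿involutive (x * y)))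

  #0-cancelˡ : ∀ {x y} → x # 0# → x * y ≈ 0# → y ≈ 0#
  #0-cancelˡ {x} {y} x#0 xy≈0 = begin
    y                       ≈⟨ *-identityˡ y ⟨
    1# * y                  ≈⟨ *-congʳ (trans (*-comm _ x) (inverseʳ x#0)) ⟨
    (inverse x#0 * x) * y   ≈⟨ *-assoc _ x y ⟩
    inverse x#0 * (x * y)   ≈⟨ *-congˡ xy≈0 ⟩
    inverse x#0 * 0#        ≈⟨ zeroʳ _ ⟩
    0#                      ∎

  2x≈0⇒x≈0 : ∀ {x} → (1# + 1#) # 0# → x + x ≈ 0# → x ≈ 0#
  2x≈0⇒x≈0 {x} 2#0 x+x≈0 = #0-cancelˡ 2#0
    (trans (distribʳ x 1# 1#) (trans (+-cong (*-identityˡ x) (*-identityˡ x)) x+x≈0))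

-- Self-duality as the vanishing of quadratic forms.

module Correspondence {c ℓ₁ ℓ₂} (K : HeytingField c ℓ₁ ℓ₂) (p q m : ℕ) where
  open HeytingField K using (_#_)
  open SelfDuality K
  open CommutativeRing commutativeRing hiding (zero)
  open RingProperties ring
  open HeytingFieldProperties K
  open SemiringSum semiring using (sum; sum-cong-≋; *-distribˡ-sum)
  open BilinearForms commutativeRing
  open CliffordFamilies K p q (matrixAlgebra m)
  open SetoidReasoning setoid
  private module M = Algebra (matrixAlgebra m)

  sign-elim : ∀ {ℓ} (Q : Carrier → Set ℓ) → Q 1# → Q (- 1#) → ∀ k → Q (sign k)
  sign-elim Q Q1 Q-1 = ++-elim p (λ k → Q (sign k))
    (λ i → ≡.subst Q (≡.sym (sign-↑ˡ i)) Q1)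
    (λ j → ≡.subst Q (≡.sym (sign-↑ʳ j)) Q-1)

  -1*-1≈1 : - 1# * - 1# ≈ 1#
  -1*-1≈1 = trans (-1*x≈-x (- 1#)) (-‿involutive 1#)

  sign-square : ∀ k → sign k * sign k ≈ 1#
  sign-square = sign-elim (λ s → s * s ≈ 1#) (*-identityˡ 1#) -1*-1≈1

  sign#0 : ∀ k → sign k # 0#
  sign#0 k = unit⇒#0 (sign-square k)

  -- The Gram matrix of `P`, with the signs on its diagonal.
  signature : Matrix (p ℕ.+ q)
  signature i j = sign i * 1ᴹ i j

  signature-diagonal : ∀ k → signature k k ≈ sign k
  signature-diagonal k = trans (*-congˡ (1ᴹ-diagonal k)) (*-identityʳ (sign k))

  signature-offDiagonal : ∀ {k l} → k ≢ l → signature k l ≈ 0#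
  signature-offDiagonal k≢l = trans (*-congˡ (1ᴹ-offDiagonal k≢l)) (zeroʳ _)

  P≈signature : ∀ v → P p q v ≈ bilinearForm signature v v
  P≈signature v = sym (begin
    bilinearForm signature v v
      ≈⟨ sum-cong-≋ (λ k → sum-cong-≋ λ l → begin
           v k * (sign k * 1ᴹ k l) * v l   ≈⟨ *-congʳ (*-assoc (v k) (sign k) (1ᴹ k l)) ⟨
           v k * sign k * 1ᴹ k l * v l     ≈⟨ *-congʳ (*-comm _ (1ᴹ k l)) ⟩
           1ᴹ k l * (v k * sign k) * v l   ≈⟨ *-assoc _ _ _ ⟩
           1ᴹ k l * (v k * sign k * v l)   ∎) ⟩
    (sum λ k → sum λ l → 1ᴹ k l * (v k * sign k * v l))
      ≈⟨ sum-cong-≋ (λ k → sum-δ k λ l → v k * sign k * v l) ⟩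
    (sum λ k → v k * sign k * v k)
      ≈⟨ sum-++ p _ ⟩
    (sum λ i → v (i ↑ˡ q) * sign (i ↑ˡ q) * v (i ↑ˡ q)) +
    (sum λ j → v (p ↑ʳ j) * sign (p ↑ʳ j) * v (p ↑ʳ j))
      ≈⟨ +-cong (sum-cong-≋ left) (sum-cong-≋ right) ⟩
    (sum λ i → v (i ↑ˡ q) * v (i ↑ˡ q)) + (sum λ j → - 1# * (v (p ↑ʳ j) * v (p ↑ʳ j)))
      ≈⟨ +-congˡ (*-distribˡ-sum (- 1#) (λ j → v (p ↑ʳ j) * v (p ↑ʳ j))) ⟨
    (sum λ i → v (i ↑ˡ q) * v (i ↑ˡ q)) + - 1# * (sum λ j → v (p ↑ʳ j) * v (p ↑ʳ j))
      ≈⟨ +-congˡ (-1*x≈-x _) ⟩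
    P p q v ∎)
    where
    left : ∀ i → v (i ↑ˡ q) * sign (i ↑ˡ q) * v (i ↑ˡ q) ≈ v (i ↑ˡ q) * v (i ↑ˡ q)
    left i rewrite sign-↑ˡ i = *-congʳ (*-identityʳ _)
    right : ∀ j → v (p ↑ʳ j) * sign (p ↑ʳ j) * v (p ↑ʳ j) ≈ - 1# * (v (p ↑ʳ j) * v (p ↑ʳ j))
    right j rewrite sign-↑ʳ j = trans (*-congʳ (*-comm _ _)) (*-assoc _ _ _)

  φ≈ : ∀ (ω : Ω p q) k → φ p q ω k ≈ inverse (proj₂ ω) * (sign k * proj₁ ω k)
  φ≈ (v , Pv#0) = ++-elim p _
    (λ i → *-congˡ (trans (reflexive (lookup-++ˡ {n = q} v₊ v₋ i)) (left i)))
    (λ j → *-congˡ (trans (reflexive (lookup-++ʳ {m = p} v₊ v₋ j)) (right j)))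
    where
    v₊ = λ i → v (i ↑ˡ q)
    v₋ = λ j → - v (p ↑ʳ j)
    left : ∀ i → v (i ↑ˡ q) ≈ sign (i ↑ˡ q) * v (i ↑ˡ q)
    left i rewrite sign-↑ˡ i = sym (*-identityˡ _)
    right : ∀ j → - v (p ↑ʳ j) ≈ sign (p ↑ʳ j) * v (p ↑ʳ j)
    right j rewrite sign-↑ʳ j = sym (-1*x≈-x _)

  module _ (S : Vector (Matrix m) (p ℕ.+ q)) where

    -- This is `S[ v ]` for a bare family of matrices. Accordingly `SelfDual` below unfolds to the
    -- same condition as `IsSelfDual`, without a quadratic mapping or symmetry attached.
    combination : Vector Carrier (p ℕ.+ q) → Matrix m
    combination v a b = sum λ i → v i * S i a b

    -- The coefficient matrix, in v, of the (a , b) entry of P(v) S(v) S(φ(v)).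
    coefficient : Fin m → Fin m → Matrix (p ℕ.+ q)
    coefficient a b i j = sign j * (S i *ᴹ S j) a b

    defect : Fin m → Fin m → Matrix (p ℕ.+ q)
    defect a b i j = coefficient a b i j + - 1ᴹ a b * signature i j

    SelfDual : Set (c ⊔ ℓ₁ ⊔ ℓ₂)
    SelfDual = ∀ (ω : Ω p q) → combination (proj₁ ω) *ᴹ combination (φ p q ω) ≈ᴹ 1ᴹ

    -- Up to the scalar 1/P(v), the vector φ(v) is v with signs. Moving the signs from the vector
    -- into the coefficients leaves a quadratic form in v alone.
    product≈ : ∀ (ω : Ω p q) a b →
      (combination (proj₁ ω) *ᴹ combination (φ p q ω)) a b ≈
      inverse (proj₂ ω) * bilinearForm (coefficient a b) (proj₁ ω) (proj₁ ω)
    product≈ ω@(v , Pv#0) a b = begin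
      (combination v *ᴹ combination (φ p q ω)) a b
        ≈⟨ bilinearForm-*ᴹ S v (φ p q ω) a b ⟩
      bilinearForm X v (φ p q ω)
        ≈⟨ bilinearForm-congʳ X v (φ≈ ω) ⟩
      bilinearForm X v (λ j → inverse Pv#0 * (sign j * v j))
        ≈⟨ bilinearForm-*ʳ X (inverse Pv#0) v (λ j → sign j * v j) ⟩
      inverse Pv#0 * bilinearForm X v (λ j → sign j * v j)
        ≈⟨ *-congˡ (sum-cong₂ λ i j → begin
             v i * X i j * (sign j * v j)   ≈⟨ *-assoc _ (sign j) (v j) ⟨
             v i * X i j * sign j * v j     ≈⟨ *-congʳ (*-assoc (v i) (X i j) (sign j)) ⟩
             v i * (X i j * sign j) * v j   ≈⟨ *-congʳ (*-congˡ (*-comm (X i j) (sign j))) ⟩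
             v i * (sign j * X i j) * v j   ∎) ⟩
      inverse Pv#0 * bilinearForm (coefficient a b) v v ∎
      where
      X : Matrix (p ℕ.+ q)
      X i j = (S i *ᴹ S j) a b

    defect-form : ∀ a b v →
      bilinearForm (defect a b) v v ≈ bilinearForm (coefficient a b) v v - P p q v * 1ᴹ a b
    defect-form a b v = begin
      bilinearForm (defect a b) v v
        ≈⟨ bilinearForm-linearᴹ (coefficient a b) signature (- 1ᴹ a b) v v ⟩
      bilinearForm (coefficient a b) v v + - 1ᴹ a b * bilinearForm signature v v
        ≈⟨ +-congˡ (*-congˡ (P≈signature v)) ⟨
      bilinearForm (coefficient a b) v v + - 1ᴹ a b * P p q v
        ≈⟨ +-congˡ (trans (sym (-‿distribˡ-* _ _)) (-‿cong (*-comm _ _))) ⟩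
      bilinearForm (coefficient a b) v v - P p q v * 1ᴹ a b ∎

    selfDual⇒defect-form≈0 : SelfDual → ∀ a b v → P p q v # 0# →
      bilinearForm (defect a b) v v ≈ 0#
    selfDual⇒defect-form≈0 selfDual a b v Pv#0 = trans (defect-form a b v)
      (trans (+-congʳ (begin
        F                           ≈⟨ *-identityˡ F ⟨
        1# * F                      ≈⟨ *-congʳ (inverseʳ Pv#0) ⟨
        P p q v * inverse Pv#0 * F  ≈⟨ *-assoc _ _ F ⟩
        P p q v * (inverse Pv#0 * F)
          ≈⟨ *-congˡ (trans (sym (product≈ (v , Pv#0) a b)) (selfDual (v , Pv#0) a b)) ⟩
        P p q v * 1ᴹ a b            ∎))
      (-‿inverseʳ _))
      where F = bilinearForm (coefficient a b) v v

    defect-form≈0⇒selfDual : (∀ a b v → bilinearForm (defect a b) v v ≈ 0#) → SelfDual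
    defect-form≈0⇒selfDual vanishes ω@(v , Pv#0) a b = begin
      (combination v *ᴹ combination (φ p q ω)) a b
        ≈⟨ product≈ ω a b ⟩
      inverse Pv#0 * F
        ≈⟨ *-congˡ (x∙y⁻¹≈ε⇒x≈y _ _ (trans (sym (defect-form a b v)) (vanishes a b v))) ⟩
      inverse Pv#0 * (P p q v * 1ᴹ a b)
        ≈⟨ *-assoc _ _ _ ⟨
      inverse Pv#0 * P p q v * 1ᴹ a b
        ≈⟨ *-congʳ (trans (*-comm _ _) (inverseʳ Pv#0)) ⟩
      1# * 1ᴹ a b
        ≈⟨ *-identityˡ _ ⟩
      1ᴹ a b ∎
      where F = bilinearForm (coefficient a b) v v

    defect-diagonal : ∀ a b k → defect a b k k ≈ sign k * ((S k *ᴹ S k) a b - 1ᴹ a b)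
    defect-diagonal a b k = begin
      sign k * (S k *ᴹ S k) a b + - 1ᴹ a b * signature k k
        ≈⟨ +-congˡ (*-congˡ (signature-diagonal k)) ⟩
      sign k * (S k *ᴹ S k) a b + - 1ᴹ a b * sign k
        ≈⟨ +-congˡ (*-comm _ _) ⟩
      sign k * (S k *ᴹ S k) a b + sign k * - 1ᴹ a b
        ≈⟨ distribˡ _ _ _ ⟨
      sign k * ((S k *ᴹ S k) a b - 1ᴹ a b) ∎

    defect-offDiagonal : ∀ a b {k l} → k ≢ l → defect a b k l ≈ coefficient a b k l
    defect-offDiagonal a b k≢l = trans
      (+-congˡ (trans (*-congˡ (signature-offDiagonal k≢l)) (zeroʳ _))) (+-identityʳ _)

    -- The symmetrized defect vanishes, on the diagonal by `square` and elsewhere by `twisted`. Its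
    -- form is twice that of the defect, so 2 must be cancelled.
    family⇒selfDual : (1# + 1#) # 0# → IsCliffordFamily S → SelfDual
    family⇒selfDual 2#0 isFamily = defect-form≈0⇒selfDual λ a b v → 2x≈0⇒x≈0 2#0
      (trans (sym (bilinearForm-symmetrized (defect a b) v)) (bilinearForm-zeroᴹ v v (vanishes a b)))
      where
      open IsCliffordFamily isFamily
      diagonal : ∀ a b k → defect a b k k ≈ 0#
      diagonal a b k = trans (defect-diagonal a b k)
        (trans (*-congˡ (trans (+-congʳ (square k a b)) (-‿inverseʳ (1ᴹ a b)))) (zeroʳ (sign k)))
      vanishes : ∀ a b → symmetrized (defect a b) ≈ᴹ 0ᴹ
      vanishes a b k l = case k ≟ l of λ where
        (yes ≡.refl) → trans (+-cong (diagonal a b k) (diagonal a b k)) (+-identityˡ 0#)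
        (no  k≢l)    → trans
          (+-cong (defect-offDiagonal a b k≢l) (defect-offDiagonal a b (k≢l ∘ ≡.sym)))
          -- The sum of the two off-diagonal coefficients is, by unfolding, the (a , b) entry of the
          -- twisted relation.
          (twisted k≢l a b)

  -- Polarization: coefficients recovered from values of a form.

  -- Three values suffice: the first two remove the diagonal terms from the third, which leaves `t`
  -- times the symmetrized entry. Keeping `t` free allows the third vector to be chosen inside Ω.
  form≈0⇒symmetrized≈0 : ∀ {n t} (X : Matrix n) k l → t # 0# →
    bilinearForm X (1ᴹ k) (1ᴹ k) ≈ 0# → bilinearForm X (1ᴹ l) (1ᴹ l) ≈ 0# →
    (let v = λ a → 1ᴹ k a + t * 1ᴹ l a in bilinearForm X v v ≈ 0#) →
    symmetrized X k l ≈ 0#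
  form≈0⇒symmetrized≈0 {t = t} X k l t#0 qk ql qkl = #0-cancelˡ t#0 (begin
    t * (X k l + X l k)
      ≈⟨ +-identityˡ _ ⟨
    0# + t * (X k l + X l k)
      ≈⟨ +-congʳ (trans (+-cong (Xii≈0 k qk) t²X≈0) (+-identityˡ 0#)) ⟨
    (X k k + t * (t * X l l)) + t * (X k l + X l k)
      ≈⟨ bilinearForm-polarize-δ X t k l ⟨
    bilinearForm X (λ a → 1ᴹ k a + t * 1ᴹ l a) (λ a → 1ᴹ k a + t * 1ᴹ l a)
      ≈⟨ qkl ⟩
    0# ∎)
    where
    Xii≈0 : ∀ i → bilinearForm X (1ᴹ i) (1ᴹ i) ≈ 0# → X i i ≈ 0#
    Xii≈0 i q = trans (sym (bilinearForm-δ X i i)) q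
    t²X≈0 : t * (t * X l l) ≈ 0#
    t²X≈0 = trans (*-congˡ (trans (*-congˡ (Xii≈0 l ql)) (zeroʳ t))) (zeroʳ t)

  -- The difference of the two matrices is symmetric, so its symmetrization is its double, and that
  -- vanishes by polarization.
  quadraticForm-injective : (1# + 1#) # 0# → ∀ {n} {S T : Matrix n} →
    IsSymmetric S → IsSymmetric T → (∀ w → quadraticForm S w ≈ quadraticForm T w) → S ≈ᴹ T
  quadraticForm-injective 2#0 {n} {S} {T} S-symmetric T-symmetric S≈T i j =
    x∙y⁻¹≈ε⇒x≈y _ _ (trans (+-congˡ (sym (-1*x≈-x (T i j))))
      (2x≈0⇒x≈0 2#0 (trans (+-congˡ (sym D-symmetric))
        -- Here `t` is 1: the forms agree at every vector, so there is no isotropic vector to avoid.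
        (form≈0⇒symmetrized≈0 D i j (unit⇒#0 (*-identityˡ 1#)) (D≈0 _) (D≈0 _) (D≈0 _)))))
    where
    D : Matrix n
    D k l = S k l + - 1# * T k l
    D-symmetric : D j i ≈ D i j
    D-symmetric = +-cong (S-symmetric j i) (*-congˡ (T-symmetric j i))
    D≈0 : ∀ w → bilinearForm D w w ≈ 0#
    D≈0 w = trans (bilinearForm-linearᴹ S T (- 1#) w w)
      (trans (+-cong (S≈T w) (-1*x≈-x _)) (-‿inverseʳ _))

  ρ-ι : ∀ (h : AlgebraHomomorphism (cliffordTensor p q) (matrixAlgebra m)) →
    let open AlgebraHomomorphism h in
    ∀ v → ⟦ ι p q v ⟧ ≈ᴹ combination (λ k → ⟦ e p q k ⟧) v
  ρ-ι h v a b = begin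
    ⟦ ι p q v ⟧ a b
      ≈⟨ sum-homo h (λ i → v i T.• e p q i) a b ⟩
    M.sum (λ i → ⟦ v i T.• e p q i ⟧) a b
      ≈⟨ matrix-sum (λ i → ⟦ v i T.• e p q i ⟧) a b ⟩
    (sum λ i → ⟦ v i T.• e p q i ⟧ a b)
      ≈⟨ sum-cong-≋ (λ i → •-homo (v i) (e p q i) a b) ⟩
    combination (λ k → ⟦ e p q k ⟧) v a b ∎
    where
    open AlgebraHomomorphism h
    module T = Algebra (cliffordTensor p q)

  -- P(eₖ + t eₗ) is one of ± 1 ± t², so t is assumed to keep these away from 0.
  module _ (t : Carrier) (2#0 : (1# + 1#) # 0#) (t#0 : t # 0#)
      (1+t²#0 : (1# + t * t) # 0#) (1-t²#0 : (1# - t * t) # 0#) where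

    P-δ#0 : ∀ k → P p q (1ᴹ k) # 0#
    P-δ#0 k = #0-resp-≈
      (sym (trans (P≈signature (1ᴹ k)) (trans (bilinearForm-δ signature k k) (signature-diagonal k))))
      (sign#0 k)

    -- Up to an overall sign, the four sign patterns produce only `1# + t * t` and `1# - t * t`.
    sign+t²sign#0 : ∀ k l → (sign k + t * (t * sign l)) # 0#
    sign+t²sign#0 k l = sign-elim (λ s → (s + t * (t * sign l)) # 0#)
      (sign-elim (λ s → (1# + t * (t * s)) # 0#)
        (#0-resp-≈ (+-congˡ (sym t[t1]≈t²)) 1+t²#0)
        (#0-resp-≈ (+-congˡ (sym t[t-1]≈-t²)) 1-t²#0) l)
      (sign-elim (λ s → (- 1# + t * (t * s)) # 0#)
        (#0-resp-≈
          (trans (sym (-‿+-comm _ _)) (+-congˡ (trans (-‿involutive _) (sym t[t1]≈t²))))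
          (#0-‿ 1-t²#0))
        (#0-resp-≈ (trans (sym (-‿+-comm _ _)) (+-congˡ (sym t[t-1]≈-t²))) (#0-‿ 1+t²#0)) l)
      k
      where
      t[t1]≈t² : t * (t * 1#) ≈ t * t
      t[t1]≈t² = *-congˡ (*-identityʳ t)
      t[t-1]≈-t² : t * (t * - 1#) ≈ - (t * t)
      t[t-1]≈-t² = trans (*-congˡ (trans (sym (-‿distribʳ-* t 1#)) (-‿cong (*-identityʳ t))))
        (sym (-‿distribʳ-* t t))

    P-polarize#0 : ∀ {k l} → k ≢ l → P p q (λ a → 1ᴹ k a + t * 1ᴹ l a) # 0#
    P-polarize#0 {k} {l} k≢l = #0-resp-≈ (sym (begin
      P p q (λ a → 1ᴹ k a + t * 1ᴹ l a)
        ≈⟨ P≈signature _ ⟩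
      bilinearForm signature (λ a → 1ᴹ k a + t * 1ᴹ l a) (λ a → 1ᴹ k a + t * 1ᴹ l a)
        ≈⟨ bilinearForm-polarize-δ signature t k l ⟩
      (signature k k + t * (t * signature l l)) + t * (signature k l + signature l k)
        ≈⟨ +-cong (+-cong (signature-diagonal k) (*-congˡ (*-congˡ (signature-diagonal l))))
             (*-congˡ (+-cong (signature-offDiagonal k≢l) (signature-offDiagonal (k≢l ∘ ≡.sym)))) ⟩
      (sign k + t * (t * sign l)) + t * (0# + 0#)
        ≈⟨ +-congˡ (trans (*-congˡ (+-identityˡ 0#)) (zeroʳ t)) ⟩
      (sign k + t * (t * sign l)) + 0#
        ≈⟨ +-identityʳ _ ⟩
      sign k + t * (t * sign l) ∎)) (sign+t²sign#0 k l)

    selfDual⇒family : ∀ S → SelfDual S → IsCliffordFamily S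
    selfDual⇒family S selfDual = record
      { square  = λ k a b → x∙y⁻¹≈ε⇒x≈y _ _ (#0-cancelˡ (sign#0 k)
          (trans (sym (defect-diagonal S a b k))
            (trans (sym (bilinearForm-δ (defect S a b) k k)) (atδ a b k))))
      ; twisted = λ {k} {l} k≢l a b → trans
          (sym (+-cong (defect-offDiagonal S a b k≢l) (defect-offDiagonal S a b (k≢l ∘ ≡.sym))))
          (form≈0⇒symmetrized≈0 (defect S a b) k l t#0 (atδ a b k) (atδ a b l)
            (selfDual⇒defect-form≈0 S selfDual a b _ (P-polarize#0 k≢l)))
      }
      where
      atδ : ∀ a b k → bilinearForm (defect S a b) (1ᴹ k) (1ᴹ k) ≈ 0#
      atδ a b k = selfDual⇒defect-form≈0 S selfDual a b (1ᴹ k) (P-δ#0 k)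

    -- The two passages between representations and self-dual mappings.

    toMapping : SymmetricRepresentation p q m → SelfDualMapping p q m
    toMapping R = record
      { quadraticMapping = record
        { Q           = λ w i → quadraticForm (ρ (e p q i)) w
        ; S           = λ i → ρ (e p q i)
        -- Symmetry is given on the image of `ι`, so eᵢ is first replaced by `ι` of the i-th
        -- standard basis vector.
        ; S-symmetric = λ i a b → trans (sym (ρ[ι-δ]≈ρ[e] i a b))
            (trans (ρ[V]-symmetric (1ᴹ i) a b) (ρ[ι-δ]≈ρ[e] i b a))
        ; Q≈          = λ w i → refl
        }
      ; isSelfDual = family⇒selfDual (λ i → ρ (e p q i)) 2#0 (homomorphism⇒family homomorphism)
      }
      where
      open SymmetricRepresentation R
      ρ[ι-δ]≈ρ[e] : ∀ i → ρ (ι p q (1ᴹ i)) ≈ᴹ ρ (e p q i)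
      ρ[ι-δ]≈ρ[e] i a b = trans (ρ-ι homomorphism (1ᴹ i) a b) (sum-δ i (λ k → ρ (e p q k) a b))

    toRepresentation : SelfDualMapping p q m → SymmetricRepresentation p q m
    toRepresentation F = record
      { homomorphism   = h
      ; ρ[V]-symmetric = λ v a b → trans (ρ[ι]≈S v a b)
          (trans (sum-cong-≋ λ i → *-congˡ (S-symmetric i a b)) (sym (ρ[ι]≈S v b a)))
      }
      where
      open SelfDualMapping F
      isFamily = selfDual⇒family S isSelfDual
      h = family⇒homomorphism isFamily
      ρ[ι]≈S : ∀ v → AlgebraHomomorphism.⟦_⟧ h (ι p q v) ≈ᴹ combination S v
      ρ[ι]≈S v a b = trans (ρ-ι h v a b)
        (sum-cong-≋ λ i → *-congˡ (family⇒homomorphism-e isFamily i a b))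

    correspondence : Bijection (symmetricRepresentations p q m) (selfDualMappings p q m)
    correspondence = record
      { to        = toMapping
      ; cong      = λ R≈R′ w i → bilinearForm-congᴹ w w (R≈R′ (e p q i))
      -- Surjectivity asks that every `R` equal to the chosen preimage be sent to `F`. The equality
      -- `R≈` is therefore used at each eᵢ before passing to the forms.
      ; bijective = (λ {R} {R′} → injective R R′) , λ F → toRepresentation F , λ {R} R≈ w i →
          trans (bilinearForm-congᴹ w w (λ a b → trans (R≈ (e p q i) a b) (ρ[e]≈S F i a b)))
            (sym (SelfDualMapping.Q≈ F w i))
      }
      where
      ρ[e]≈S : ∀ F i → SymmetricRepresentation.ρ (toRepresentation F) (e p q i) ≈ᴹ SelfDualMapping.S F i
      ρ[e]≈S F = family⇒homomorphism-e (selfDual⇒family (SelfDualMapping.S F) (SelfDualMapping.isSelfDual F))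

      -- Equal maps Q have equal symmetric matrices, so the two representations agree on every eₖ
      -- and hence everywhere.
      injective : ∀ R R′ → let module F = SelfDualMapping (toMapping R)
                               module F′ = SelfDualMapping (toMapping R′)
                           in (∀ w i → F.Q w i ≈ F′.Q w i) →
        ∀ x → SymmetricRepresentation.ρ R x ≈ᴹ SymmetricRepresentation.ρ R′ x
      injective R R′ Q≈Q′ = homomorphism-unique
        (SymmetricRepresentation.homomorphism R) (SymmetricRepresentation.homomorphism R′)
        λ k → quadraticForm-injective 2#0
          (SelfDualMapping.S-symmetric (toMapping R) k) (SelfDualMapping.S-symmetric (toMapping R′) k)
          λ w → Q≈Q′ w k

-- Specialisation to the real numbers.

open import Defs
open import Data.Nat using (_+_; _≤_)

theorem2p2 : (p q m : ℕ) → 1 ≤ p + q →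
    Σ[ β ∈ Bijection (symmetricRepresentations p q m) (selfDualMappings p q m) ]
      (∀ (R : SymmetricRepresentation p q m) →
        let open SymmetricRepresentation R using (ρ)
            open SelfDualMapping (Bijection.to β R)
        in (∀ i → S i ≈ᴹ ρ (e p q i)) ×
           (∀ (w : Vector Real.ℝ m) i → Q w i Real.≈ quadraticForm (ρ (e p q i)) w))
theorem2p2 p q m _ =
    -- With `t` equal to 2, the elements 1 + t² and 1 - t² are 5 and -3, with inverses 1/5 and -1/3.
    -- All these reals are constant sequences, so each product is checked by computing with
    -- rationals.
    correspondence t (unit⇒#0 2·½≈1) (unit⇒#0 2·½≈1)
      (unit⇒#0 {y = fromℚ (ℤ.+ 1 ℚ./ 5)} (≗⇒≈ λ _ → ≡.refl))
      (unit⇒#0 {y = fromℚ (ℤ.- ℤ.+ 1 ℚ./ 3)} (≗⇒≈ λ _ → ≡.refl))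
  , λ R → (λ i a b → ℝ.refl) , (λ w i → ℝ.refl)
  where
  open Real using (_⊕_; _·_; fromℚ; ≗⇒≈)
  open Correspondence Real.heytingField p q m using (correspondence)
  open HeytingFieldProperties Real.heytingField using (unit⇒#0)
  module ℝ = CommutativeRing Real.commutativeRing
  t = fromℚ ℚ.1ℚ ⊕ fromℚ ℚ.1ℚ
  2·½≈1 : t · fromℚ ℚ.½ Real.≈ fromℚ ℚ.1ℚ
  2·½≈1 = ≗⇒≈ λ _ → ≡.refl
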